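{- Let $T$ be a tree with a vertex of degree $d$. For any $s\ge 1$, any straight-line drawing of $T$ with spanning ratio at most $s$ has edge-length ratio in $2^{\Omega(d/s^2)}$.
   Context: A straight-line drawing maps vertices to distinct points and edges to straight-line segments. In a straight-line drawing $\Gamma$, $\pi_\Gamma(u,v)$ is the minimum total Euclidean length of a path between $u$ and $v$, $\|uv\|_\Gamma$ is their Euclidean distance, and the spanning ratio is $\max_{u\neq v}\pi_\Gamma(u,v)/\|uv\|_\Gamma$. The edge-length ratio is the ratio between the lengths of the longest and shortest edges. The $\Omega$ notation hides an absolute constant (independent of $T$, $d$, $s$). -}

module Defs where

open import Data.Nat as ℕ using (ℕ; zero; suc)
import Data.Nat.Properties as ℕ
open import Data.Integer as ℤ using (ℤ; +_; -[1+_])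
import Data.Integer.Properties as ℤ
open import Data.Integer.Tactic.RingSolver using (solve-∀)
open import Data.Rational as ℚ using (ℚ; 0ℚ; 1ℚ; ½)
import Data.Rational.Properties as ℚ
open import Data.Fin using (Fin; zero; suc)
import Data.Fin.Properties as Fin
open import Data.List as List using (List; []; _∷_)
import Data.List.Properties as List
open import Data.List.Membership.Propositional using (_∈_)
import Data.List.Membership.Propositional.Properties as ∈
open import Data.List.Relation.Unary.All as All using (All; []; _∷_)
import Data.List.Relation.Unary.All.Properties as All
open import Data.List.Relation.Unary.AllPairs using (_∷_)
open import Data.List.Relation.Unary.Any using (here; there)
open import Data.List.Relation.Unary.Linked using (Linked; linked?)
open import Data.List.Relation.Unary.Unique.Propositional using (Unique)
open import Data.List.Relation.Unary.Unique.DecPropositional using (unique?)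
open import Data.Maybe as Maybe using (just)
import Data.Maybe.Properties as Maybe
open import Data.Product using (∃; Σ; _×_; _,_; proj₁; proj₂)
open import Data.Sum using (_⊎_; inj₁; inj₂)
open import Data.Empty using (⊥-elim)
open import Relation.Nullary using (¬_; Dec; yes; no)
open import Relation.Nullary.Decidable using (_×-dec_; ¬?; dec⇒maybe)
open import Relation.Binary.PropositionalEquality

module Rationals where

  open import Data.Rational
  open import Data.Rational.Properties
  open import Data.Rational.Solver using (module +-*-Solver)
  open +-*-Solver
  import Data.Rational.Unnormalised as ℚᵘ
  import Data.Rational.Unnormalised.Properties as ℚᵘ
  open import Algebra.Bundles using (CommutativeRing)
  open import Algebra.Properties.CommutativeSemiring.Exp (CommutativeRing.commutativeSemiring +-*-commutativeRing) public

  fromℕ : ℕ → ℚ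
  fromℕ k = + k / 1

  unit : ℕ → ℚ
  unit n = + 1 / suc n

  ≤-cast : ∀ {a b c d} → a ≡ b → c ≡ d → b ≤ d → a ≤ c
  ≤-cast refl refl p = p

  <-cast : ∀ {a b c d} → a ≡ b → c ≡ d → b < d → a < c
  <-cast refl refl p = p

  *-mono : ∀ {a b c d} → 0ℚ ≤ a → 0ℚ ≤ d → a ≤ b → c ≤ d → a * c ≤ b * d
  *-mono {a} {b} {c} {d} 0≤a 0≤d a≤b c≤d =
    ≤-trans (*-monoˡ-≤-nonNeg a {{nonNegative 0≤a}} c≤d) (*-monoʳ-≤-nonNeg d {{nonNegative 0≤d}} a≤b)

  0≤* : ∀ {a b} → 0ℚ ≤ a → 0ℚ ≤ b → 0ℚ ≤ a * b
  0≤* {a} {b} p q = ≤-cast (sym (*-zeroˡ 0ℚ)) refl (*-mono ≤-refl q p q)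

  0<* : ∀ {a b} → 0ℚ < a → 0ℚ < b → 0ℚ < a * b
  0<* {a} {b} p q = positive⁻¹ (a * b) {{pos*pos⇒pos a {{positive p}} b {{positive q}}}}

  *-monoʳ-< : ∀ {a b c} → 0ℚ < a → b < c → a * b < a * c
  *-monoʳ-< {a} p = *-monoʳ-<-pos a {{positive p}}

  0<1 : 0ℚ < 1ℚ
  0<1 = positive⁻¹ 1ℚ

  0≤1 : 0ℚ ≤ 1ℚ
  0≤1 = <⇒≤ 0<1

  0<½* : ∀ {ε} → 0ℚ < ε → 0ℚ < ½ * ε
  0<½* p = 0<* (positive⁻¹ ½) p

  p≤p+q : ∀ {p q} → 0ℚ ≤ q → p ≤ p + q
  p≤p+q {p} {q} 0≤q = ≤-cast (sym (+-identityʳ p)) refl (+-monoʳ-≤ p 0≤q)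

  p<p+q : ∀ {p q} → 0ℚ < q → p < p + q
  p<p+q {p} {q} 0<q = <-cast (sym (+-identityʳ p)) refl (+-monoʳ-< p 0<q)

  p≤∣p∣ : ∀ p → p ≤ ∣ p ∣
  p≤∣p∣ p with ≤-total 0ℚ p
  ... | inj₁ q = ≤-reflexive (sym (0≤p⇒∣p∣≡p q))
  ... | inj₂ q = ≤-trans q (0≤∣p∣ p)

  ∣-∣-< : ∀ {p ε} → p < ε → - p < ε → ∣ p ∣ < ε
  ∣-∣-< {p} a b with ∣p∣≡p∨∣p∣≡-p p
  ... | inj₁ e = <-cast e refl a
  ... | inj₂ e = <-cast e refl b

  <+⇒-< : ∀ {p q ε} → p < q + ε → p - q < ε
  <+⇒-< {p} {q} {ε} h = <-cast refl (solve 2 (λ q ε → ε := (q :+ ε) :+ (:- q)) refl q ε) (+-monoˡ-< (- q) h)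

  -<⇒<+ : ∀ {p q ε} → p - q < ε → p < q + ε
  -<⇒<+ {p} {q} {ε} h = <-cast (solve 2 (λ p q → p := q :+ (p :+ (:- q))) refl p q) refl (+-monoʳ-< q h)

  halves : ∀ ε → ½ * ε + ½ * ε ≡ ε
  halves = solve 1 (λ ε → con ½ :* ε :+ con ½ :* ε := ε) refl

  0≤^ : ∀ {a} k → 0ℚ ≤ a → 0ℚ ≤ a ^ k
  0≤^ zero p = 0≤1
  0≤^ (suc k) p = 0≤* p (0≤^ k p)

  0<^ : ∀ {a} k → 0ℚ < a → 0ℚ < a ^ k
  0<^ zero p = 0<1
  0<^ (suc k) p = 0<* p (0<^ k p)

  ^-mono : ∀ {a b} k → 0ℚ ≤ a → a ≤ b → a ^ k ≤ b ^ k
  ^-mono zero p q = ≤-refl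
  ^-mono (suc k) p q = *-mono p (0≤^ k (≤-trans p q)) q (^-mono k p q)

  ^-mono-< : ∀ {a b} k → 0ℚ ≤ a → a < b → a ^ suc k < b ^ suc k
  ^-mono-< {a} {b} k p q =
    ≤-<-trans (*-monoˡ-≤-nonNeg a {{nonNegative p}} (^-mono k p (<⇒≤ q)))
              (*-monoˡ-<-pos (b ^ k) {{positive (0<^ k (≤-<-trans p q))}} q)

  ^-cancel : ∀ {a b} k → 0ℚ ≤ b → a ^ suc k ≤ b ^ suc k → a ≤ b
  ^-cancel {a} {b} k 0≤b h with a ≤? b
  ... | yes p = p
  ... | no ¬p = ⊥-elim (<-irrefl refl (<-≤-trans (^-mono-< k 0≤b (≰⇒> ¬p)) h))

  ^-cancel-< : ∀ {a b} k → 0ℚ ≤ b → a ^ k < b ^ k → a < b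
  ^-cancel-< {a} {b} k 0≤b h with a <? b
  ... | yes p = p
  ... | no ¬p = ⊥-elim (<-irrefl refl (<-≤-trans h (^-mono k 0≤b (≮⇒≥ ¬p))))

  1≤^ : ∀ {a} k → 1ℚ ≤ a → 1ℚ ≤ a ^ k
  1≤^ zero p = ≤-refl
  1≤^ (suc k) p = ≤-cast (sym (*-identityˡ 1ℚ)) refl (*-mono 0≤1 (0≤^ k (≤-trans 0≤1 p)) p (1≤^ k p))

  ≤^ : ∀ {a} k → 1ℚ ≤ a → a ≤ a ^ suc k
  ≤^ {a} k p = ≤-cast (sym (*-identityʳ a)) refl (*-monoˡ-≤-nonNeg a {{nonNegative (≤-trans 0≤1 p)}} (1≤^ k p))

  ^-mono-exp : ∀ {a j k} → 1ℚ ≤ a → j ℕ.≤ k → a ^ j ≤ a ^ k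
  ^-mono-exp {a} {j} {k} p j≤k =
    ≤-cast (sym (*-identityʳ (a ^ j))) (trans (cong (a ^_) (sym (ℕ.m+[n∸m]≡n j≤k))) (^-homo-* a j (k ℕ.∸ j)))
      (*-monoˡ-≤-nonNeg (a ^ j) {{nonNegative (0≤^ j (≤-trans 0≤1 p))}} (1≤^ (k ℕ.∸ j) p))

  fromℚᵘ-* : ∀ p q → fromℚᵘ (p ℚᵘ.* q) ≡ fromℚᵘ p * fromℚᵘ q
  fromℚᵘ-* p q = toℚᵘ-injective (ℚᵘ.≃-trans (toℚᵘ-fromℚᵘ (p ℚᵘ.* q))
    (ℚᵘ.≃-sym (ℚᵘ.≃-trans (toℚᵘ-homo-* (fromℚᵘ p) (fromℚᵘ q)) (ℚᵘ.*-cong (toℚᵘ-fromℚᵘ p) (toℚᵘ-fromℚᵘ q)))))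

  fromℚᵘ-+ : ∀ p q → fromℚᵘ (p ℚᵘ.+ q) ≡ fromℚᵘ p + fromℚᵘ q
  fromℚᵘ-+ p q = toℚᵘ-injective (ℚᵘ.≃-trans (toℚᵘ-fromℚᵘ (p ℚᵘ.+ q))
    (ℚᵘ.≃-sym (ℚᵘ.≃-trans (toℚᵘ-homo-+ (fromℚᵘ p) (fromℚᵘ q)) (ℚᵘ.+-cong (toℚᵘ-fromℚᵘ p) (toℚᵘ-fromℚᵘ q)))))

  fromℚᵘ-mono : ∀ {p q} → p ℚᵘ.≤ q → fromℚᵘ p ≤ fromℚᵘ q
  fromℚᵘ-mono {p} {q} h = toℚᵘ-cancel-≤ (ℚᵘ.≤-trans (ℚᵘ.≤-reflexive (toℚᵘ-fromℚᵘ p))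
    (ℚᵘ.≤-trans h (ℚᵘ.≤-reflexive (ℚᵘ.≃-sym (toℚᵘ-fromℚᵘ q)))))

  frac-suc : ∀ k n → + suc k / suc n ≡ + k / suc n + unit n
  frac-suc k n = trans (fromℚᵘ-cong {ℚᵘ.mkℚᵘ (+ suc k) n} {ℚᵘ.mkℚᵘ (+ k) n ℚᵘ.+ ℚᵘ.mkℚᵘ (+ 1) n} (ℚᵘ.*≡* (lem (+ k) (+ suc n))))
     (fromℚᵘ-+ (ℚᵘ.mkℚᵘ (+ k) n) (ℚᵘ.mkℚᵘ (+ 1) n))
    where
    lem : ∀ k s → (+ 1 ℤ.+ k) ℤ.* (s ℤ.* s) ≡ (k ℤ.* s ℤ.+ + 1 ℤ.* s) ℤ.* s
    lem = solve-∀

  frac≡ : ∀ k n → + k / suc n ≡ fromℕ k * unit n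
  frac≡ k n = trans (fromℚᵘ-cong {ℚᵘ.mkℚᵘ (+ k) n} {ℚᵘ.mkℚᵘ (+ k) 0 ℚᵘ.* ℚᵘ.mkℚᵘ (+ 1) n} (ℚᵘ.*≡* (lem (+ k) (+ suc n))))
     (fromℚᵘ-* (ℚᵘ.mkℚᵘ (+ k) 0) (ℚᵘ.mkℚᵘ (+ 1) n))
    where
    lem : ∀ k s → k ℤ.* (+ 1 ℤ.* s) ≡ (k ℤ.* + 1) ℤ.* s
    lem = solve-∀

  frac-self : ∀ n → + suc n / suc n ≡ 1ℚ
  frac-self n = fromℚᵘ-cong {ℚᵘ.mkℚᵘ (+ suc n) n} {ℚᵘ.mkℚᵘ (+ 1) 0} (ℚᵘ.*≡* (ℤ.*-comm (+ suc n) (+ 1)))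

  frac-full : ∀ b n → + (suc n ℕ.* b) / suc n ≡ fromℕ b
  frac-full b n = fromℚᵘ-cong {ℚᵘ.mkℚᵘ (+ (suc n ℕ.* b)) n} {ℚᵘ.mkℚᵘ (+ b) 0}
    (ℚᵘ.*≡* (trans (cong (ℤ._* + 1) (ℤ.pos-* (suc n) b)) (lem (+ suc n) (+ b))))
    where
    lem : ∀ s b → (s ℤ.* b) ℤ.* + 1 ≡ b ℤ.* s
    lem = solve-∀

  0≤frac : ∀ k n → 0ℚ ≤ + k / suc n
  0≤frac k n = nonNegative⁻¹ (+ k / suc n) {{normalize-nonNeg k (suc n)}}

  0<unit : ∀ n → 0ℚ < unit n
  0<unit n = positive⁻¹ (unit n) {{normalize-pos 1 (suc n)}}

  unit-antimono : ∀ {m n} → m ℕ.≤ n → unit n ≤ unit m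
  unit-antimono {m} {n} h = fromℚᵘ-mono {ℚᵘ.mkℚᵘ (+ 1) n} {ℚᵘ.mkℚᵘ (+ 1) m}
    (ℚᵘ.*≤* (ℤ.*-monoˡ-≤-nonNeg (+ 1) (ℤ.+≤+ (ℕ.s≤s h))))

  archimedean : ∀ {ε} → 0ℚ < ε → ∃ λ n → unit n ≤ ε
  archimedean {mkℚ (+ zero) d c} (*<* (ℤ.+<+ h)) = ⊥-elim (ℕ.n≮0 h)
  archimedean {mkℚ -[1+ k ] d c} (*<* ())
  archimedean {ε@(mkℚ (+ suc k) d c)} h = d , ≤-cast refl (sym (↥p/↧p≡p ε))
    (fromℚᵘ-mono {ℚᵘ.mkℚᵘ (+ 1) d} {ℚᵘ.mkℚᵘ (+ suc k) d} (ℚᵘ.*≤* (ℤ.*-monoʳ-≤-nonNeg (+ suc d) {+ 1} {+ suc k} (ℤ.+≤+ (ℕ.s≤s ℕ.z≤n)))))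

  ≤fromℕ : ∀ p → p ≤ fromℕ ℤ.∣ ↥ p ∣
  ≤fromℕ p@(mkℚ n d c) = ≤-cast (sym (↥p/↧p≡p p)) refl
    (fromℚᵘ-mono {ℚᵘ.mkℚᵘ n d} {ℚᵘ.mkℚᵘ (+ ℤ.∣ n ∣) 0}
      (ℚᵘ.*≤* (ℤ.≤-trans (ℤ.≤-reflexive (ℤ.*-identityʳ n)) (ℤ.≤-trans (i≤∣i∣ n) (ℤ.≤-trans (ℤ.≤-reflexive (sym (ℤ.*-identityʳ (+ ℤ.∣ n ∣)))) (ℤ.*-monoˡ-≤-nonNeg (+ ℤ.∣ n ∣) (ℤ.+≤+ (ℕ.s≤s ℕ.z≤n))))))))
    where
    i≤∣i∣ : ∀ i → i ℤ.≤ + ℤ.∣ i ∣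
    i≤∣i∣ (+ n) = ℤ.≤-refl
    i≤∣i∣ -[1+ n ] = ℤ.-≤+

  bernoulli : ∀ {t} k → 0ℚ ≤ t → 1ℚ + fromℕ k * t ≤ (1ℚ + t) ^ k
  bernoulli {t} zero p = ≤-reflexive (solve 1 (λ t → con 1ℚ :+ con 0ℚ :* t := con 1ℚ) refl t)
  bernoulli {t} (suc k) p = ≤-trans
    (≤-cast (trans (cong (λ z → 1ℚ + z * t) (frac-suc k 0)) (solve 2 (λ f t → con 1ℚ :+ (f :+ con 1ℚ) :* t := con 1ℚ :+ f :* t :+ t) refl (fromℕ k) t))
            (solve 2 (λ f t → (con 1ℚ :+ t) :* (con 1ℚ :+ f :* t) := con 1ℚ :+ f :* t :+ t :+ f :* (t :* t)) refl (fromℕ k) t)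
            (p≤p+q (0≤* (0≤frac k 0) (0≤* p p))))
    (*-monoˡ-≤-nonNeg (1ℚ + t) {{nonNegative (≤-trans p (≤-cast (sym (+-identityˡ t)) refl (+-monoˡ-≤ t 0≤1)))}} (bernoulli k p))

  2≤[1+unit]^ : ∀ M → fromℕ 2 ≤ (1ℚ + unit M) ^ suc M
  2≤[1+unit]^ M = ≤-trans (≤-reflexive (cong (λ z → 1ℚ + z) (sym (trans (sym (frac≡ (suc M) M)) (frac-self M))))) (bernoulli (suc M) (<⇒≤ (0<unit M)))

  greatest : ∀ {P : ℕ → Set} → (∀ k → Dec (P k)) → ℕ → ℕ
  greatest P? zero = zero
  greatest P? (suc b) with P? (suc b)
  ... | yes _ = suc b
  ... | no  _ = greatest P? b

  greatest-spec : ∀ {P : ℕ → Set} (P? : ∀ k → Dec (P k)) b → P 0 → ¬ P (suc b) → let k = greatest P? b in P k × ¬ P (suc k)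
  greatest-spec P? zero p q = p , q
  greatest-spec P? (suc b) p q with P? (suc b)
  ... | yes r = r , q
  ... | no  r = greatest-spec P? b p r

  bound-spec : ∀ q n a (B : ℕ) → B ≡ suc n ℕ.* suc ℤ.∣ ↥ a ∣ → ¬ ((+ suc B / suc n) ^ suc q ≤ a)
  bound-spec q n a B refl h = <-irrefl refl (<-≤-trans (<-≤-trans a< (≤^ q 1≤)) h)
    where
    eq : + suc B / suc n ≡ fromℕ ℤ.∣ ↥ a ∣ + 1ℚ + unit n
    eq = trans (frac-suc B n) (cong (_+ unit n) (trans (frac-full (suc ℤ.∣ ↥ a ∣) n) (frac-suc ℤ.∣ ↥ a ∣ 0)))
    1≤ : 1ℚ ≤ + suc B / suc n
    1≤ = ≤-cast refl eq (≤-trans (≤-cast (sym (+-identityˡ 1ℚ)) refl (+-monoˡ-≤ 1ℚ (0≤frac ℤ.∣ ↥ a ∣ 0))) (p≤p+q (<⇒≤ (0<unit n))))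
    a< : a < + suc B / suc n
    a< = <-cast refl eq (≤-<-trans (≤-trans (≤fromℕ a) (p≤p+q 0≤1)) (p<p+q (0<unit n)))

  search-spec : ∀ q n {a} → 0ℚ ≤ a → ∀ B → ¬ ((+ suc B / suc n) ^ suc q ≤ a) →
    let r = + greatest (λ k → (+ k / suc n) ^ suc q ≤? a) B / suc n in r ^ suc q ≤ a × a < (r + unit n) ^ suc q
  search-spec q n {a} 0≤a B top =
      proj₁ spec
    , <-cast refl (cong (_^ suc q) (sym (frac-suc (greatest (λ k → (+ k / suc n) ^ suc q ≤? a) B) n))) (≰⇒> (proj₂ spec))
    where
    spec = greatest-spec {λ k → (+ k / suc n) ^ suc q ≤ a} (λ k → (+ k / suc n) ^ suc q ≤? a) B
      (≤-cast (trans (cong (λ z → z * z ^ q) (0/n≡0 (suc n))) (*-zeroˡ (0ℚ ^ q))) refl 0≤a) top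

  opaque
    -- The largest multiple r of 1/(n+1) with r ^ q ≤ a, i.e. the q-th root of a
    -- rounded down to precision 1/(n+1) (see root-spec).
    root : ℕ → ℕ → ℚ → ℚ
    root q n a = + greatest (λ k → (+ k / suc n) ^ q ≤? a) (suc n ℕ.* suc ℤ.∣ ↥ a ∣) / suc n

    0≤root : ∀ q n a → 0ℚ ≤ root q n a
    0≤root q n a = 0≤frac (greatest (λ k → (+ k / suc n) ^ q ≤? a) (suc n ℕ.* suc ℤ.∣ ↥ a ∣)) n

    root-spec : ∀ q n {a} → 0ℚ ≤ a → root (suc q) n a ^ suc q ≤ a × a < (root (suc q) n a + unit n) ^ suc q
    root-spec q n {a} 0≤a = search-spec q n 0≤a (suc n ℕ.* suc ℤ.∣ ↥ a ∣) (bound-spec q n a _ refl)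

  square-+ : ∀ {r ε} → 0ℚ ≤ r → 0ℚ ≤ ε → r ^ 2 + ε * ε ≤ (r + ε) ^ 2
  square-+ {r} {ε} 0≤r 0≤ε =
    ≤-cast (solve 2 (λ r e → r :* (r :* con 1ℚ) :+ e :* e := r :* r :+ e :* e) refl r ε)
           (solve 2 (λ r e → (r :+ e) :* ((r :+ e) :* con 1ℚ) := r :* r :+ e :* e :+ (r :* e :+ r :* e)) refl r ε)
           (p≤p+q (≤-trans (0≤* 0≤r 0≤ε) (p≤p+q (0≤* 0≤r 0≤ε))))

  √-close : ∀ {a b r t δ ε} → 0ℚ ≤ t → 0ℚ ≤ δ → 0ℚ < ε → r ^ 2 ≤ a → a < b + ε * ε → b < (t + δ) ^ 2 → r < t + δ + ε
  √-close {a} {b} {r} {t} {δ} {ε} 0≤t 0≤δ 0<ε lo h hi = ^-cancel-< 2 (≤-trans 0≤t+δ (p≤p+q (<⇒≤ 0<ε)))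
     (≤-<-trans lo (<-≤-trans h (≤-trans (+-monoˡ-≤ (ε * ε) (<⇒≤ hi)) (square-+ 0≤t+δ (<⇒≤ 0<ε)))))
    where
    0≤t+δ : 0ℚ ≤ t + δ
    0≤t+δ = ≤-trans 0≤t (p≤p+q 0≤δ)

  2^ℤ_ : ℤ → ℚ
  2^ℤ (+ k)    = fromℕ 2 ^ k
  2^ℤ -[1+ k ] = ½ ^ suc k

  _⁺ _⁻ : ℤ → ℕ
  (+ k) ⁺    = k
  -[1+ k ] ⁺ = 0
  (+ k) ⁻    = 0
  -[1+ k ] ⁻ = suc k

  ⁺-⁻ : ∀ z → z ≡ + (z ⁺) ℤ.- + (z ⁻)
  ⁺-⁻ (+ k)    = sym (ℤ.+-identityʳ (+ k))
  ⁺-⁻ -[1+ k ] = refl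

  ½^*2^ : ∀ k → ½ ^ k * fromℕ 2 ^ k ≡ 1ℚ
  ½^*2^ k = trans (sym (^-distrib-* ½ (fromℕ 2) k)) (1^ k)
    where
    1^ : ∀ k → 1ℚ ^ k ≡ 1ℚ
    1^ zero    = refl
    1^ (suc k) = trans (*-identityˡ (1ℚ ^ k)) (1^ k)

  2^ℤ-spec : ∀ z → 2^ℤ z * fromℕ 2 ^ (z ⁻) ≡ fromℕ 2 ^ (z ⁺)
  2^ℤ-spec (+ k)    = *-identityʳ (fromℕ 2 ^ k)
  2^ℤ-spec -[1+ k ] = ½^*2^ (suc k)

  0<2 : 0ℚ < fromℕ 2
  0<2 = positive⁻¹ (fromℕ 2)

  1≤2 : 1ℚ ≤ fromℕ 2
  1≤2 = *≤* (ℤ.+≤+ (ℕ.s≤s ℕ.z≤n))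

  0≤2^ℤ : ∀ z → 0ℚ ≤ 2^ℤ z
  0≤2^ℤ (+ k)    = 0≤^ k (<⇒≤ 0<2)
  0≤2^ℤ -[1+ k ] = 0≤^ (suc k) (<⇒≤ (positive⁻¹ ½))

  -- If A ≤ 2 ^ (i / (a+1)), 2 ^ (j / (b+1)) ≤ B and i / (a+1) ≤ j / (b+1) + 1 / (M+1),
  -- then A ≤ B * (1 + 1 / (M+1)), by comparing (a+1)(b+1)(M+1)-th powers.
  module _ {A B : ℚ} (i j : ℤ) (a b M : ℕ) (0≤A : 0ℚ ≤ A) (0≤B : 0ℚ ≤ B)
           (A≤ : A ^ suc a ≤ 2^ℤ i) (≤B : 2^ℤ j ≤ B ^ suc b)
           (i≤j : i ℤ.* (+ suc b ℤ.* + suc M) ℤ.≤ (j ℤ.* + suc M ℤ.+ + 1 ℤ.* + suc b) ℤ.* + suc a) where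

    private
      t = fromℕ 2
      e f g E : ℕ
      e = suc b ℕ.* suc M
      f = suc a ℕ.* suc M
      g = suc a ℕ.* suc b
      E = suc a ℕ.* e

      suc-b*f : suc b ℕ.* f ≡ E
      suc-b*f = lem (suc a) (suc b) (suc M)
        where
        open import Data.Nat.Tactic.RingSolver renaming (solve-∀ to solveℕ)
        lem : ∀ x y z → y ℕ.* (x ℕ.* z) ≡ x ℕ.* (y ℕ.* z)
        lem = solveℕ

      suc-M*g : suc M ℕ.* g ≡ E
      suc-M*g = lem (suc a) (suc b) (suc M)
        where
        open import Data.Nat.Tactic.RingSolver renaming (solve-∀ to solveℕ)
        lem : ∀ x y z → z ℕ.* (x ℕ.* y) ≡ x ℕ.* (y ℕ.* z)
        lem = solveℕ

      exponents : i ⁺ ℕ.* e ℕ.+ j ⁻ ℕ.* f ℕ.≤ j ⁺ ℕ.* f ℕ.+ i ⁻ ℕ.* e ℕ.+ g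
      exponents = ℤ.drop‿+≤+ (subst₂ ℤ._≤_ lhs rhs (ℤ.+-monoˡ-≤ c (subst₂ (λ i j → i ℤ.* (sb ℤ.* sM) ℤ.≤ (j ℤ.* sM ℤ.+ + 1 ℤ.* sb) ℤ.* sa) (⁺-⁻ i) (⁺-⁻ j) i≤j)))
        where
        sa = + suc a
        sb = + suc b
        sM = + suc M
        c = + (i ⁻) ℤ.* (sb ℤ.* sM) ℤ.+ + (j ⁻) ℤ.* (sa ℤ.* sM)
        pos-e : ∀ k → + (k ℕ.* e) ≡ + k ℤ.* (sb ℤ.* sM)
        pos-e k = trans (ℤ.pos-* k e) (cong (+ k ℤ.*_) (ℤ.pos-* (suc b) (suc M)))
        pos-f : ∀ k → + (k ℕ.* f) ≡ + k ℤ.* (sa ℤ.* sM)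
        pos-f k = trans (ℤ.pos-* k f) (cong (+ k ℤ.*_) (ℤ.pos-* (suc a) (suc M)))
        lem₁ : ∀ ip im jm x y z → (ip ℤ.- im) ℤ.* (y ℤ.* z) ℤ.+ (im ℤ.* (y ℤ.* z) ℤ.+ jm ℤ.* (x ℤ.* z)) ≡ ip ℤ.* (y ℤ.* z) ℤ.+ jm ℤ.* (x ℤ.* z)
        lem₁ = solve-∀
        lem₂ : ∀ im jp jm x y z → ((jp ℤ.- jm) ℤ.* z ℤ.+ + 1 ℤ.* y) ℤ.* x ℤ.+ (im ℤ.* (y ℤ.* z) ℤ.+ jm ℤ.* (x ℤ.* z)) ≡ jp ℤ.* (x ℤ.* z) ℤ.+ im ℤ.* (y ℤ.* z) ℤ.+ x ℤ.* y
        lem₂ = solve-∀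
        lhs = trans (lem₁ (+ (i ⁺)) (+ (i ⁻)) (+ (j ⁻)) sa sb sM) (sym (trans (ℤ.pos-+ (i ⁺ ℕ.* e) (j ⁻ ℕ.* f)) (cong₂ ℤ._+_ (pos-e (i ⁺)) (pos-f (j ⁻)))))
        rhs = trans (lem₂ (+ (i ⁻)) (+ (j ⁺)) (+ (j ⁻)) sa sb sM) (sym (trans (ℤ.pos-+ (j ⁺ ℕ.* f ℕ.+ i ⁻ ℕ.* e) g)
                (cong₂ ℤ._+_ (trans (ℤ.pos-+ (j ⁺ ℕ.* f) (i ⁻ ℕ.* e)) (cong₂ ℤ._+_ (pos-f (j ⁺)) (pos-e (i ⁻)))) (ℤ.pos-* (suc a) (suc b)))))

      0≤2^ : ∀ k → 0ℚ ≤ t ^ k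
      0≤2^ k = 0≤^ k (<⇒≤ 0<2)

      power-eq : ∀ X l k n → (X ^ suc n * t ^ l) ^ k ≡ X ^ (suc n ℕ.* k) * t ^ (l ℕ.* k)
      power-eq X l k n = trans (^-distrib-* (X ^ suc n) (t ^ l) k) (cong₂ _*_ (^-assocʳ X (suc n) k) (^-assocʳ t l k))

      lower : A ^ E * t ^ (i ⁻ ℕ.* e) ≤ t ^ (i ⁺ ℕ.* e)
      lower = ≤-cast (sym (power-eq A (i ⁻) e a)) (sym (^-assocʳ t (i ⁺) e))
        (^-mono e (0≤* (0≤^ (suc a) 0≤A) (0≤2^ (i ⁻)))
          (≤-cast refl (sym (2^ℤ-spec i)) (*-monoʳ-≤-nonNeg (t ^ (i ⁻)) {{nonNegative (0≤2^ (i ⁻))}} A≤)))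

      upper : t ^ (j ⁺ ℕ.* f) ≤ B ^ E * t ^ (j ⁻ ℕ.* f)
      upper = ≤-cast (sym (^-assocʳ t (j ⁺) f)) (trans (cong (λ z → B ^ z * t ^ (j ⁻ ℕ.* f)) (sym suc-b*f)) (sym (power-eq B (j ⁻) f b)))
        (^-mono f (0≤2^ (j ⁺))
          (≤-cast (sym (2^ℤ-spec j)) refl (*-monoʳ-≤-nonNeg (t ^ (j ⁻)) {{nonNegative (0≤2^ (j ⁻))}} ≤B)))

      x y : ℚ
      x = t ^ (j ⁺ ℕ.* f)
      y = t ^ (i ⁻ ℕ.* e)

      combined : (x * y) * A ^ E ≤ (x * y) * (B ^ E * t ^ g)
      combined = ≤-trans
        (≤-cast (assoc₁ x y (A ^ E)) refl (*-mono (0≤* (0≤^ E 0≤A) (0≤2^ (i ⁻ ℕ.* e))) (0≤* (0≤^ E 0≤B) (0≤2^ (j ⁻ ℕ.* f))) lower upper))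
        (≤-cast (trans (assoc₂ (t ^ (i ⁺ ℕ.* e)) (B ^ E) (t ^ (j ⁻ ℕ.* f))) (cong (B ^ E *_) (sym (^-homo-* t (i ⁺ ℕ.* e) (j ⁻ ℕ.* f)))))
                (trans (assoc₃ x y (B ^ E) (t ^ g)) (cong (B ^ E *_) (trans (cong (_* t ^ g) (sym (^-homo-* t (j ⁺ ℕ.* f) (i ⁻ ℕ.* e)))) (sym (^-homo-* t (j ⁺ ℕ.* f ℕ.+ i ⁻ ℕ.* e) g)))))
                (*-monoˡ-≤-nonNeg (B ^ E) {{nonNegative (0≤^ E 0≤B)}} (^-mono-exp 1≤2 exponents)))
        where
        assoc₁ : ∀ x y z → (x * y) * z ≡ (z * y) * x
        assoc₁ = solve 3 (λ x y z → (x :* y) :* z := (z :* y) :* x) refl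
        assoc₂ : ∀ x y z → x * (y * z) ≡ y * (x * z)
        assoc₂ = solve 3 (λ x y z → x :* (y :* z) := y :* (x :* z)) refl
        assoc₃ : ∀ x y z w → (x * y) * (z * w) ≡ z * ((x * y) * w)
        assoc₃ = solve 4 (λ x y z w → (x :* y) :* (z :* w) := z :* ((x :* y) :* w)) refl

      2^g≤ : t ^ g ≤ (1ℚ + unit M) ^ E
      2^g≤ = ≤-cast refl (sym (trans (^-assocʳ (1ℚ + unit M) (suc M) g) (cong ((1ℚ + unit M) ^_) suc-M*g)))
        (^-mono g (<⇒≤ 0<2) (2≤[1+unit]^ M))

    2^-close : A ≤ B * (1ℚ + unit M)
    2^-close = ^-cancel (ℕ.pred E) (0≤* 0≤B (≤-trans 0≤1 (p≤p+q (<⇒≤ (0<unit M)))))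
      (≤-cast refl (^-distrib-* B (1ℚ + unit M) E)
        (≤-trans (*-cancelˡ-≤-pos (x * y) {{positive (0<* (0<^ (j ⁺ ℕ.* f) 0<2) (0<^ (i ⁻ ℕ.* e) 0<2))}} combined)
                 (*-monoˡ-≤-nonNeg (B ^ E) {{nonNegative (0≤^ E 0≤B)}} 2^g≤)))

  ≤-cross : ∀ p q M → p ≤ q + unit M →
    ↥ p ℤ.* (↧ q ℤ.* + suc M) ℤ.≤ (↥ q ℤ.* + suc M ℤ.+ + 1 ℤ.* ↧ q) ℤ.* ↧ p
  ≤-cross p@(mkℚ _ _ _) q@(mkℚ _ _ _) M h = subst (λ z → ↥ p ℤ.* z ℤ.≤ (↥ q ℤ.* + suc M ℤ.+ + 1 ℤ.* ↧ q) ℤ.* ↧ p) (ℤ.pos-* (↧ₙ q) (suc M)) (ℚᵘ.drop-*≤*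
    (ℚᵘ.≤-trans (toℚᵘ-mono-≤ h) (ℚᵘ.≤-reflexive (ℚᵘ.≃-trans (toℚᵘ-homo-+ q (unit M)) (ℚᵘ.+-congʳ (toℚᵘ q) (toℚᵘ-fromℚᵘ (ℚᵘ.mkℚᵘ (+ 1) M)))))))

open Rationals using (_^_; root; 2^ℤ_)

Cauchy : (ℕ → ℚ) → Set
Cauchy x = ∀ ε → 0ℚ ℚ.< ε → ∃ λ N → ∀ m n → N ℕ.≤ m → N ℕ.≤ n → ℚ.∣ x m ℚ.- x n ∣ ℚ.< ε

module CauchyFacts where

  open Rationals
  open import Data.Rational
  open import Data.Rational.Properties
  open import Data.Rational.Solver using (module +-*-Solver)
  open +-*-Solver

  Cauchy′ : (ℕ → ℚ) → Set
  Cauchy′ x = ∀ ε → 0ℚ < ε → ∃ λ N → ∀ m n → N ℕ.≤ m → N ℕ.≤ n → x m < x n + ε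

  to : ∀ {x} → Cauchy′ x → Cauchy x
  to {x} c ε 0<ε = let N , h = c ε 0<ε in N , λ m n N≤m N≤n →
    ∣-∣-< (<+⇒-< (h m n N≤m N≤n))
          (<-cast (solve 2 (λ a b → :- (a :+ :- b) := b :+ :- a) refl (x m) (x n)) refl (<+⇒-< (h n m N≤n N≤m)))

  from : ∀ {x} → Cauchy x → Cauchy′ x
  from {x} c ε 0<ε = let N , h = c ε 0<ε in N , λ m n N≤m N≤n →
    -<⇒<+ (≤-<-trans (p≤∣p∣ (x m - x n)) (h m n N≤m N≤n))

  const-cauchy : ∀ p → Cauchy (λ _ → p)
  const-cauchy p = to {λ _ → p} λ ε 0<ε → 0 , λ _ _ _ _ → p<p+q {p} {ε} 0<ε

  -- A common threshold for two statements about the tails of sequences.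
  both : ∀ {N M k} → N ℕ.⊔ M ℕ.≤ k → N ℕ.≤ k × M ℕ.≤ k
  both {N} {M} h = ℕ.≤-trans (ℕ.m≤m⊔n N M) h , ℕ.≤-trans (ℕ.m≤n⊔m N M) h

  +-cauchy : ∀ {x y} → Cauchy x → Cauchy y → Cauchy (λ n → x n + y n)
  +-cauchy {x} {y} cx cy = to λ ε 0<ε →
    let N , h = from {x} cx (½ * ε) (0<½* 0<ε)
        M , k = from {y} cy (½ * ε) (0<½* 0<ε)
    in N ℕ.⊔ M , λ m n m≥ n≥ → <-cast refl
         (trans (cong (λ e → x n + y n + e) (sym (halves ε))) (solve 3 (λ a b e → a :+ b :+ (e :+ e) := (a :+ e) :+ (b :+ e)) refl (x n) (y n) (½ * ε)))
         (+-mono-< (h m n (proj₁ (both m≥)) (proj₁ (both n≥))) (k m n (proj₂ (both {N} m≥)) (proj₂ (both {N} n≥))))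

  neg-cauchy : ∀ {x} → Cauchy x → Cauchy (λ n → - x n)
  neg-cauchy {x} cx = to λ ε 0<ε →
    let N , h = from {x} cx ε 0<ε
    in N , λ m n m≥ n≥ → <-cast
         (solve 2 (λ a b → :- a := b :+ (:- a :+ :- b)) refl (x m) (x n))
         (solve 3 (λ a b e → :- b :+ e := (a :+ e) :+ (:- a :+ :- b)) refl (x m) (x n) ε)
         (+-monoˡ-< (- x m + - x n) (h n m n≥ m≥))

  ⊔-cauchy : ∀ {x y} → Cauchy x → Cauchy y → Cauchy (λ n → x n ⊔ y n)
  ⊔-cauchy {x} {y} cx cy = to λ ε 0<ε →
    let N , h = from {x} cx ε 0<ε
        M , k = from {y} cy ε 0<ε
    in N ℕ.⊔ M , λ m n m≥ n≥ → sel (x m) (y m)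
         (<-≤-trans (h m n (proj₁ (both m≥)) (proj₁ (both n≥))) (+-monoˡ-≤ ε (p≤p⊔q (x n) (y n))))
         (<-≤-trans (k m n (proj₂ (both {N} m≥)) (proj₂ (both {N} n≥))) (+-monoˡ-≤ ε (p≤q⊔p (x n) (y n))))
    where
    sel : ∀ p q {r} → p < r → q < r → p ⊔ q < r
    sel p q a b with ⊔-sel p q
    ... | inj₁ e = <-cast e refl a
    ... | inj₂ e = <-cast e refl b

  ⊓-cauchy : ∀ {x y} → Cauchy x → Cauchy y → Cauchy (λ n → x n ⊓ y n)
  ⊓-cauchy {x} {y} cx cy = to λ ε 0<ε →
    let N , h = from {x} cx ε 0<ε
        M , k = from {y} cy ε 0<ε
    in N ℕ.⊔ M , λ m n m≥ n≥ → sel (x n) (y n)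
         (≤-<-trans (p⊓q≤p (x m) (y m)) (h m n (proj₁ (both m≥)) (proj₁ (both n≥))))
         (≤-<-trans (p⊓q≤q (x m) (y m)) (k m n (proj₂ (both {N} m≥)) (proj₂ (both {N} n≥))))
    where
    sel : ∀ p q {r ε} → r < p + ε → r < q + ε → r < p ⊓ q + ε
    sel p q {r} {ε} a b with ⊓-sel p q
    ... | inj₁ e = <-cast refl (cong (_+ ε) e) a
    ... | inj₂ e = <-cast refl (cong (_+ ε) e) b

  bounded : ∀ {x} → Cauchy x → ∃ λ B → 0ℚ < B × ∃ λ N → ∀ n → N ℕ.≤ n → ∣ x n ∣ ≤ B
  bounded {x} cx =
    let N , h = cx 1ℚ 0<1
    in ∣ x N ∣ + 1ℚ , ≤-<-trans (0≤∣p∣ (x N)) (p<p+q 0<1) , N , λ n n≥ →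
       ≤-trans (≤-cast (cong ∣_∣ (solve 2 (λ a b → a := b :+ (a :+ :- b)) refl (x n) (x N))) refl (∣p+q∣≤∣p∣+∣q∣ (x N) (x n - x N)))
               (+-monoʳ-≤ ∣ x N ∣ (<⇒≤ (h n N n≥ ℕ.≤-refl)))

  shrink : ∀ D → 0ℚ < D → ∀ η → 0ℚ < η → ∃ λ ε → 0ℚ < ε × D * ε ≡ η
  shrink D 0<D η 0<η = η * 1/ D , 0<* 0<η (positive⁻¹ (1/ D) {{1/pos⇒pos D}}) ,
    trans (solve 3 (λ d h i → d :* (h :* i) := h :* (d :* i)) refl D η (1/ D))
      (trans (cong (η *_) (*-inverseʳ D)) (*-identityʳ η))
    where
    instance
      D+  = positive 0<D
      D≢0 = pos⇒nonZero D

  *-close : ∀ {p q p′ q′ D η ε} → 0ℚ < D → D * η ≡ ½ * ε → ∣ p ∣ ≤ D → ∣ q′ ∣ ≤ D →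
            ∣ p - p′ ∣ < η → ∣ q - q′ ∣ < η → ∣ p * q - p′ * q′ ∣ < ε
  *-close {p} {q} {p′} {q′} {D} {η} {ε} 0<D D*η p≤ q≤ dp dq = <-cast
      (cong ∣_∣ (solve 4 (λ a b c d → a :* b :+ :- (c :* d) := a :* (b :+ :- d) :+ d :* (a :+ :- c)) refl p q p′ q′))
      (sym (halves ε))
      (≤-<-trans (∣p+q∣≤∣p∣+∣q∣ (p * (q - q′)) (q′ * (p - p′))) (+-mono-< (term p≤ dq) (term q≤ dp)))
    where
    term : ∀ {r s} → ∣ r ∣ ≤ D → ∣ s ∣ < η → ∣ r * s ∣ < ½ * ε
    term {r} {s} a b = <-cast (∣p*q∣≡∣p∣*∣q∣ r s) (sym D*η)
      (≤-<-trans (*-monoʳ-≤-nonNeg ∣ s ∣ {{∣-∣-nonNeg s}} a) (*-monoʳ-< 0<D b))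

  *-cauchy : ∀ {x y} → Cauchy x → Cauchy y → Cauchy (λ n → x n * y n)
  *-cauchy {x} {y} cx cy ε 0<ε = go (bounded {x} cx) (bounded {y} cy)
    where
    Goal : Set
    Goal = ∃ λ N → ∀ m n → N ℕ.≤ m → N ℕ.≤ n → ∣ x m * y m - x n * y n ∣ < ε

    go″ : ∀ D → 0ℚ < D → ∀ N → (∀ n → N ℕ.≤ n → ∣ x n ∣ ≤ D) → (∀ n → N ℕ.≤ n → ∣ y n ∣ ≤ D) →
          ∀ η → 0ℚ < η → D * η ≡ ½ * ε → Goal
    go″ D 0<D N hx hy η 0<η D*η =
      let N₁ , h = cx η 0<η
          N₂ , k = cy η 0<η
      in N ℕ.⊔ (N₁ ℕ.⊔ N₂) , λ m n m≥ n≥ →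
         let m₀ , m′ = both {N} m≥
             n₀ , n′ = both {N} n≥
         in *-close {x m} {y m} {x n} {y n} {D} {η} {ε} 0<D D*η (hx m m₀) (hy n n₀)
              (h m n (proj₁ (both {N₁} m′)) (proj₁ (both {N₁} n′))) (k m n (proj₂ (both {N₁} m′)) (proj₂ (both {N₁} n′)))

    go′ : ∀ D → 0ℚ < D → ∀ N → (∀ n → N ℕ.≤ n → ∣ x n ∣ ≤ D) → (∀ n → N ℕ.≤ n → ∣ y n ∣ ≤ D) → Goal
    go′ D 0<D N hx hy = let η , 0<η , eq = shrink D 0<D (½ * ε) (0<½* 0<ε) in go″ D 0<D N hx hy η 0<η eq

    go : (∃ λ B → 0ℚ < B × ∃ λ N → ∀ n → N ℕ.≤ n → ∣ x n ∣ ≤ B) →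
         (∃ λ C → 0ℚ < C × ∃ λ N → ∀ n → N ℕ.≤ n → ∣ y n ∣ ≤ C) → Goal
    go (B , 0<B , N₁ , hB) (C , 0<C , N₂ , hC) = go′ (B + C) (<-trans 0<B (p<p+q {B} {C} 0<C)) (N₁ ℕ.⊔ N₂)
      (λ n n≥ → ≤-trans (hB n (proj₁ (both {N₁} n≥))) (p≤p+q {B} {C} (<⇒≤ 0<C)))
      (λ n n≥ → ≤-trans (hC n (proj₂ (both {N₁} n≥))) (≤-cast refl (+-comm B C) (p≤p+q {C} {B} (<⇒≤ 0<B))))

  inv : ℚ → ℚ
  inv p with p ≟ 0ℚ
  ... | yes _  = 0ℚ
  ... | no p≢0 = 1/_ p {{≢-nonZero p≢0}}

  inv-spec : ∀ {p} → 0ℚ < p → p * inv p ≡ 1ℚ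
  inv-spec {p} 0<p with p ≟ 0ℚ
  ... | yes e  = ⊥-elim (<-irrefl (sym e) 0<p)
  ... | no p≢0 = *-inverseʳ p {{≢-nonZero p≢0}}

  inv-cauchy : ∀ {x δ N} → 0ℚ < δ → (∀ n → N ℕ.≤ n → 0ℚ + δ < x n) → Cauchy x → Cauchy (λ n → inv (x n))
  inv-cauchy {x} {δ} {N} 0<δ pos cx = to λ ε 0<ε →
    let M , h = from {x} cx (ε * (δ * δ)) (0<* 0<ε (0<* 0<δ 0<δ))
    in N ℕ.⊔ M , λ m n m≥ n≥ →
       step 0<ε (δ< m (proj₁ (both m≥))) (δ< n (proj₁ (both n≥))) (h n m (proj₂ (both {N} n≥)) (proj₂ (both {N} m≥)))
    where
    δ< : ∀ n → N ℕ.≤ n → δ < x n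
    δ< n n≥ = <-cast (sym (+-identityˡ δ)) refl (pos n n≥)
    step : ∀ {p q ε} → 0ℚ < ε → δ < p → δ < q → q < p + ε * (δ * δ) → inv p < inv q + ε
    step {p} {q} {ε} 0<ε δ<p δ<q h = *-cancelˡ-<-nonNeg (p * q) {{nonNegative (<⇒≤ (0<* 0<p 0<q))}}
      (<-cast
        (trans (solve 3 (λ p q i → (p :* q) :* i := q :* (p :* i)) refl p q (inv p)) (trans (cong (q *_) (inv-spec 0<p)) (*-identityʳ q)))
        (trans (solve 4 (λ p q i e → (p :* q) :* (i :+ e) := p :* (q :* i) :+ e :* (p :* q)) refl p q (inv q) ε)
          (cong (_+ ε * (p * q)) (trans (cong (p *_) (inv-spec 0<q)) (*-identityʳ p))))
        (<-≤-trans h (+-monoʳ-≤ p (*-monoˡ-≤-nonNeg ε {{nonNegative (<⇒≤ 0<ε)}} (*-mono (<⇒≤ 0<δ) (<⇒≤ 0<q) (<⇒≤ δ<p) (<⇒≤ δ<q))))))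
      where
      0<p = <-trans 0<δ δ<p
      0<q = <-trans 0<δ δ<q

  √-cauchy : ∀ {x} → Cauchy x → Cauchy (λ n → root 2 n (x n ⊔ 0ℚ))
  √-cauchy {x} cx = to {λ n → root 2 n (x n ⊔ 0ℚ)} λ ε 0<ε →
    let 0<ε′ = 0<½* 0<ε
        N , h = from {λ n → x n ⊔ 0ℚ} (⊔-cauchy {x} {λ _ → 0ℚ} cx (const-cauchy 0ℚ)) (½ * ε * (½ * ε)) (0<* 0<ε′ 0<ε′)
        M , k = archimedean 0<ε′
    in N ℕ.⊔ M , λ m n m≥ n≥ →
       step (root 2 m (x m ⊔ 0ℚ)) (root 2 n (x n ⊔ 0ℚ)) (unit n) ε
         (√-close {x m ⊔ 0ℚ} {x n ⊔ 0ℚ} {root 2 m (x m ⊔ 0ℚ)} {root 2 n (x n ⊔ 0ℚ)} {unit n} {½ * ε}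
           (0≤root 2 n (x n ⊔ 0ℚ)) (<⇒≤ (0<unit n)) 0<ε′
           (proj₁ (root-spec 1 m (p≤q⊔p (x m) 0ℚ))) (h m n (proj₁ (both {N} m≥)) (proj₁ (both {N} n≥))) (proj₂ (root-spec 1 n (p≤q⊔p (x n) 0ℚ))))
         (≤-trans (unit-antimono {M} {n} (proj₂ (both {N} n≥))) k)
    where
    step : ∀ r t δ ε → r < t + δ + ½ * ε → δ ≤ ½ * ε → r < t + ε
    step r t δ ε h δ≤ = <-≤-trans h
      (≤-cast (+-assoc t δ (½ * ε)) (cong (λ z → t + z) (sym (halves ε))) (+-monoʳ-≤ t (+-monoˡ-≤ (½ * ε) δ≤)))

  root-2^ : ℕ → ℚ → ℚ
  root-2^ n r = root (↧ₙ r) n (2^ℤ ↥ r)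

  root-2^-close : ∀ {p q} m n M → p ≤ q + unit M → root-2^ m p ≤ (root-2^ n q + unit n) * (1ℚ + unit M)
  root-2^-close {p@(mkℚ i a _)} {q@(mkℚ j b _)} m n M h = 2^-close i j a b M
    (0≤root (suc a) m (2^ℤ i)) (≤-trans (0≤root (suc b) n (2^ℤ j)) (p≤p+q (<⇒≤ (0<unit n))))
    (proj₁ (root-spec a m (0≤2^ℤ i))) (<⇒≤ (proj₂ (root-spec b n (0≤2^ℤ j)))) (≤-cross p q M h)

  2^-step : ∀ {ε η} A B δ μ C → 0ℚ < C → 0ℚ < ½ * ε → A ≤ (B + δ) * (1ℚ + μ) → B + δ ≤ C → 0ℚ ≤ μ →
            δ ≤ ½ * (½ * ε) → μ ≤ η → C * η ≡ ½ * (½ * ε) → A < B + ε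
  2^-step {ε} {η} A B δ μ C 0<C 0<ε′ h b≤C 0≤μ δ≤ μ≤ C*η = ≤-<-trans h
    (<-cast (solve 3 (λ b d μ → (b :+ d) :* (con 1ℚ :+ μ) := b :+ (d :+ (b :+ d) :* μ)) refl B δ μ) refl
      (+-monoʳ-< B (≤-<-trans
        (+-mono-≤ δ≤ (≤-trans (*-monoʳ-≤-nonNeg μ {{nonNegative 0≤μ}} b≤C)
                       (≤-trans (*-monoˡ-≤-nonNeg C {{nonNegative (<⇒≤ 0<C)}} μ≤) (≤-reflexive C*η))))
        (<-cast (halves (½ * ε)) (sym (halves ε)) (p<p+q 0<ε′)))))

  root-2^-bounded : ∀ {x} → Cauchy x → ∃ λ C → 0ℚ < C × ∃ λ N → ∀ n → N ℕ.≤ n → root-2^ n (x n) + unit n ≤ C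
  root-2^-bounded {x} cx =
    let N , h = from {x} cx (unit 0) (0<unit 0)
    in (root-2^ N (x N) + unit N) * (1ℚ + unit 0) + unit 0
    , ≤-<-trans (0≤* (≤-trans (0≤root (↧ₙ (x N)) N (2^ℤ ↥ (x N))) (p≤p+q {root-2^ N (x N)} {unit N} (<⇒≤ (0<unit N)))) (≤-trans 0≤1 (p≤p+q {1ℚ} {unit 0} (<⇒≤ (0<unit 0)))))
                (p<p+q {(root-2^ N (x N) + unit N) * (1ℚ + unit 0)} {unit 0} (0<unit 0))
    , N , λ n n≥ → +-mono-≤ (root-2^-close {x n} {x N} n N 0 (<⇒≤ (h n N n≥ ℕ.≤-refl))) (unit-antimono {0} {n} ℕ.z≤n)

  2^-cauchy : ∀ {x} → Cauchy x → Cauchy (λ n → root-2^ n (x n))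
  2^-cauchy {x} cx = to go
    where
    Goal : ℚ → Set
    Goal ε = ∃ λ N → ∀ m n → N ℕ.≤ m → N ℕ.≤ n → root-2^ m (x m) < root-2^ n (x n) + ε

    go″ : ∀ {ε} → 0ℚ < ε → ∀ C → 0ℚ < C → ∀ N₀ → (∀ n → N₀ ℕ.≤ n → root-2^ n (x n) + unit n ≤ C) →
          ∀ η → C * η ≡ ½ * (½ * ε) → ∀ M → unit M ≤ η → ∀ N₂ → unit N₂ ≤ ½ * (½ * ε) → Goal ε
    go″ {ε} 0<ε C 0<C N₀ hC η C*η M hM N₂ h₂ =
      let N₁ , h₁ = from {x} cx (unit M) (0<unit M)
      in N₀ ℕ.⊔ (N₁ ℕ.⊔ N₂) , λ m n m≥ n≥ →
       let m₁ , _  = both {N₁} (proj₂ (both {N₀} m≥))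
           n₁ , n₂ = both {N₁} (proj₂ (both {N₀} n≥))
       in 2^-step {ε} {η} (root-2^ m (x m)) (root-2^ n (x n)) (unit n) (unit M) C 0<C (0<½* 0<ε)
            (root-2^-close {x m} {x n} m n M (<⇒≤ (h₁ m n m₁ n₁)))
            (hC n (proj₁ (both {N₀} n≥)))
            (<⇒≤ (0<unit M)) (≤-trans (unit-antimono n₂) h₂) hM C*η

    go′ : ∀ {ε} → 0ℚ < ε → ∀ C → 0ℚ < C → ∀ N₀ → (∀ n → N₀ ℕ.≤ n → root-2^ n (x n) + unit n ≤ C) →
          (∃ λ η → 0ℚ < η × C * η ≡ ½ * (½ * ε)) → Goal ε
    go′ {ε} 0<ε C 0<C N₀ hC (η , 0<η , C*η) =
      let M  , hM = archimedean 0<η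
          N₂ , h₂ = archimedean (0<½* (0<½* 0<ε))
      in go″ 0<ε C 0<C N₀ hC η C*η M hM N₂ h₂

    go : Cauchy′ (λ n → root-2^ n (x n))
    go ε 0<ε =
      let C , 0<C , N₀ , hC = root-2^-bounded {x} cx
      in go′ 0<ε C 0<C N₀ hC (shrink C 0<C (½ * (½ * ε)) (0<½* (0<½* 0<ε)))

open CauchyFacts

-- The reals as Cauchy sequences of rationals; two sequences denote the same real
-- number when neither is smaller than the other.
record ℝ : Set where
  constructor real
  field
    seq    : ℕ → ℚ
    cauchy : Cauchy seq

open ℝ public

infix 4 _<_ _≤_

_<_ : ℝ → ℝ → Set
x < y = ∃ λ ε → 0ℚ ℚ.< ε × ∃ λ N → ∀ n → N ℕ.≤ n → seq x n ℚ.+ ε ℚ.< seq y n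

_≤_ : ℝ → ℝ → Set
x ≤ y = ¬ (y < x)

fromℚ : ℚ → ℝ
fromℚ p = real (λ _ → p) (const-cauchy p)

fromℕ : ℕ → ℝ
fromℕ k = fromℚ (+ k ℚ./ 1)

infixl 6 _+_ _-_ _⊔_
infixl 7 _*_ _⊓_
infix  8 -_ √_ 2^_
infixl 7 _÷_⟨_⟩

_+_ : ℝ → ℝ → ℝ
x + y = real (λ n → seq x n ℚ.+ seq y n) (+-cauchy {seq x} {seq y} (cauchy x) (cauchy y))

-_ : ℝ → ℝ
- x = real (λ n → ℚ.- seq x n) (neg-cauchy {seq x} (cauchy x))

_-_ : ℝ → ℝ → ℝ
x - y = x + - y

_*_ : ℝ → ℝ → ℝ
x * y = real (λ n → seq x n ℚ.* seq y n) (*-cauchy {seq x} {seq y} (cauchy x) (cauchy y))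

_⊔_ : ℝ → ℝ → ℝ
x ⊔ y = real (λ n → seq x n ℚ.⊔ seq y n) (⊔-cauchy {seq x} {seq y} (cauchy x) (cauchy y))

_⊓_ : ℝ → ℝ → ℝ
x ⊓ y = real (λ n → seq x n ℚ.⊓ seq y n) (⊓-cauchy {seq x} {seq y} (cauchy x) (cauchy y))

_÷_⟨_⟩ : ℝ → (y : ℝ) → fromℕ 0 < y → ℝ
x ÷ y ⟨ _ , 0<ε , _ , pos ⟩ = x * real (λ n → inv (seq y n)) (inv-cauchy {seq y} 0<ε pos (cauchy y))

-- √ x = 0 for x < 0.
√_ : ℝ → ℝ
√ x = real (λ n → root 2 n (seq x n ℚ.⊔ 0ℚ)) (√-cauchy {seq x} (cauchy x))

-- The n-th approximation is the q-th root of 2 ^ p, where p / q is the n-th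
-- approximation of the exponent, rounded down to precision 1/(n+1).
2^_ : ℝ → ℝ
2^ x = real (λ n → root-2^ n (seq x n)) (2^-cauchy {seq x} (cauchy x))

0<-⊓ : ∀ x y → fromℕ 0 < x → fromℕ 0 < y → fromℕ 0 < x ⊓ y
0<-⊓ x y (ε , 0<ε , N , h) (δ , 0<δ , M , k) =
  ε ℚ.⊓ δ , sel {ε} {δ} 0<ε 0<δ , N ℕ.⊔ M , λ n n≥ → sel {seq x n} {seq y n}
    (ℚ.≤-<-trans (ℚ.+-monoʳ-≤ 0ℚ (ℚ.p⊓q≤p ε δ)) (h n (proj₁ (both {N} n≥))))
    (ℚ.≤-<-trans (ℚ.+-monoʳ-≤ 0ℚ (ℚ.p⊓q≤q ε δ)) (k n (proj₂ (both {N} n≥))))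
  where
  sel : ∀ {p q r} → r ℚ.< p → r ℚ.< q → r ℚ.< p ℚ.⊓ q
  sel {p} {q} a b with ℚ.⊓-sel p q
  ... | inj₁ e = Rationals.<-cast refl e a
  ... | inj₂ e = Rationals.<-cast refl e b

1≤⇒0< : ∀ s → fromℕ 1 ≤ s → fromℕ 0 < s
1≤⇒0< s 1≤s = go (from {seq s} (cauchy s) ¼ 0<¼)
  where
  ¼ : ℚ
  ¼ = + 1 ℚ./ 4
  0<¼ : 0ℚ ℚ.< ¼
  0<¼ = ℚ.positive⁻¹ ¼
  go : (∃ λ N → ∀ m n → N ℕ.≤ m → N ℕ.≤ n → seq s m ℚ.< seq s n ℚ.+ ¼) → fromℕ 0 < s
  go (N , h) = decide (½ ℚ.≤? seq s N)
    where
    decide : Dec (½ ℚ.≤ seq s N) → fromℕ 0 < s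
    decide (yes p) = ¼ , 0<¼ , N , λ n n≥ →
      Rationals.<+⇒-< {½} {¼} (Rationals.<-cast refl (ℚ.+-comm ¼ (seq s n)) (ℚ.≤-<-trans p (h N n ℕ.≤-refl n≥)))
    decide (no ¬p) = ⊥-elim (1≤s (¼ , 0<¼ , N , λ n n≥ →
      ℚ.<-trans (ℚ.+-monoˡ-< ¼ (h n N n≥ ℕ.≤-refl)) (ℚ.+-monoˡ-< ¼ (ℚ.+-monoˡ-< ¼ (ℚ.≰⇒> ¬p)))))

0<⇒0<² : ∀ s → fromℕ 0 < s → fromℕ 0 < s * s
0<⇒0<² s (ε , 0<ε , N , h) = ε ℚ.* ε , Rationals.0<* 0<ε 0<ε , N , λ n n≥ →
  square (seq s n) (Rationals.<-cast (sym (ℚ.+-identityˡ ε)) refl (h n n≥))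
  where
  square : ∀ p → ε ℚ.< p → 0ℚ ℚ.+ ε ℚ.* ε ℚ.< p ℚ.* p
  square p ε<p = Rationals.<-cast (ℚ.+-identityˡ (ε ℚ.* ε)) refl
    (ℚ.<-trans (Rationals.*-monoʳ-< {ε} {ε} {p} 0<ε ε<p) (ℚ.*-monoˡ-<-pos p {{ℚ.positive (ℚ.<-trans 0<ε ε<p)}} ε<p))

-- The maximum of a finite list of nonnegative reals, 0 for the empty list.
maximum : List ℝ → ℝ
maximum = List.foldr _⊔_ (fromℕ 0)

minimum : (xs : List ℝ) → xs ≢ [] → ℝ
minimum []       ne = ⊥-elim (ne refl)
minimum (x ∷ xs) _  = List.foldr _⊓_ x xs

minimum-positive : ∀ xs ne → All (fromℕ 0 <_) xs → fromℕ 0 < minimum xs ne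
minimum-positive []       ne _        = ⊥-elim (ne refl)
minimum-positive (x ∷ xs) _  (p ∷ ps) = go xs ps
  where
  go : ∀ ys → All (fromℕ 0 <_) ys → fromℕ 0 < List.foldr _⊓_ x ys
  go []       []       = p
  go (y ∷ ys) (q ∷ qs) = 0<-⊓ y (List.foldr _⊓_ x ys) q (go ys qs)

map-≢[] : ∀ {A : Set} (f : A → ℝ) xs → xs ≢ [] → List.map f xs ≢ []
map-≢[] f []       ne _ = ne refl
map-≢[] f (x ∷ xs) ne ()

∈⇒≢[] : ∀ {A : Set} {x : A} {xs} → x ∈ xs → xs ≢ []
∈⇒≢[] (here _)  ()
∈⇒≢[] (there _) ()

record Graph (n : ℕ) : Set₁ where
  infix 4 _~_ _~?_
  field
    _~_    : Fin n → Fin n → Set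
    _~?_   : ∀ u v → Dec (u ~ v)
    ~-sym  : ∀ {u v} → u ~ v → v ~ u
    irrefl : ∀ {u} → ¬ (u ~ u)

module _ {n : ℕ} (G : Graph n) where

  open Graph G

  degree : Fin n → ℕ
  degree v = List.length (List.filter (v ~?_) (List.allFin n))

  IsPath : Fin n → Fin n → List (Fin n) → Set
  IsPath u v p = Linked _~_ p × Unique p × List.head p ≡ just u × List.last p ≡ just v

  Connected : Set
  Connected = ∀ u v → ∃ (IsPath u v)

  -- A cycle is a path on at least three vertices whose ends are adjacent.
  Acyclic : Set
  Acyclic = ∀ {u v p} → IsPath u v p → 3 ℕ.≤ List.length p → ¬ (v ~ u)

  record IsTree : Set where
    field
      connected : Connected
      acyclic   : Acyclic

  isPath? : ∀ u v p → Dec (IsPath u v p)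
  isPath? u v p = linked? _~?_ p ×-dec unique? Fin._≟_ p
    ×-dec Maybe.≡-dec Fin._≟_ (List.head p) (just u) ×-dec Maybe.≡-dec Fin._≟_ (List.last p) (just v)

  listsUpTo : ℕ → List (List (Fin n))
  listsUpTo zero    = [] ∷ []
  listsUpTo (suc k) = [] ∷ List.cartesianProductWith _∷_ (List.allFin n) (listsUpTo k)

  -- All paths from u to v; being duplicate-free, they have at most n vertices.
  paths : Fin n → Fin n → List (List (Fin n))
  paths u v = List.filter (isPath? u v) (listsUpTo n)

  ∈-listsUpTo : ∀ k xs → List.length xs ℕ.≤ k → xs ∈ listsUpTo k
  ∈-listsUpTo zero    []       _         = here refl
  ∈-listsUpTo (suc k) []       _         = here refl
  ∈-listsUpTo (suc k) (x ∷ xs) (ℕ.s≤s h) =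
    there (∈.∈-cartesianProductWith⁺ _∷_ (∈.∈-allFin x) (∈-listsUpTo k xs h))

  lookup-injective : ∀ {xs : List (Fin n)} → Unique xs → ∀ {i j} → List.lookup xs i ≡ List.lookup xs j → i ≡ j
  lookup-injective {_ ∷ _}  (_ ∷ _) {zero}  {zero}  _ = refl
  lookup-injective {_ ∷ xs} (x∉ ∷ _) {zero}  {suc j} e = ⊥-elim (All.lookup x∉ (∈.∈-lookup {xs = xs} j) e)
  lookup-injective {_ ∷ xs} (x∉ ∷ _) {suc i} {zero}  e = ⊥-elim (All.lookup x∉ (∈.∈-lookup {xs = xs} i) (sym e))
  lookup-injective {_ ∷ _}  (_ ∷ u) {suc i} {suc j} e = cong suc (lookup-injective u e)

  path∈paths : ∀ {u v p} → IsPath u v p → p ∈ paths u v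
  path∈paths {u} {v} {p} h@(_ , unique , _) =
    ∈.∈-filter⁺ (isPath? u v) (∈-listsUpTo n p (Fin.injective⇒≤ (lookup-injective unique))) h

  paths≢[] : Connected → ∀ u v → paths u v ≢ []
  paths≢[] conn u v = ∈⇒≢[] (path∈paths (proj₂ (conn u v)))

  -- Every edge is listed once in each direction.
  edges : List (∃ λ u → ∃ λ v → u ~ v)
  edges = List.mapMaybe (λ (u , v) → Maybe.map (λ e → u , v , e) (dec⇒maybe (u ~? v)))
    (List.cartesianProduct (List.allFin n) (List.allFin n))

  HasEdge : Set
  HasEdge = edges ≢ []

distinctPairs : ∀ n → List (∃ λ (u : Fin n) → ∃ λ (v : Fin n) → u ≢ v)
distinctPairs n = List.mapMaybe (λ (u , v) → Maybe.map (λ e → u , v , e) (dec⇒maybe (¬? (u Fin.≟ v))))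
  (List.cartesianProduct (List.allFin n) (List.allFin n))

Point : Set
Point = ℝ × ℝ

dist : Point → Point → ℝ
dist (x , y) (x′ , y′) = √ ((x - x′) * (x - x′) + (y - y′) * (y - y′))

-- A straight-line drawing is determined by the positions of the vertices.
-- Distinctness of points is the constructive one: positive distance.
record Drawing {n : ℕ} (G : Graph n) : Set where
  field
    position : Fin n → Point
    distinct : ∀ {u v} → u ≢ v → fromℕ 0 < dist (position u) (position v)

module _ {n : ℕ} {G : Graph n} (Γ : Drawing G) where

  open Graph G
  open Drawing Γ

  ∥_,_∥ : Fin n → Fin n → ℝ
  ∥ u , v ∥ = dist (position u) (position v)

  pathLength : List (Fin n) → ℝ
  pathLength []           = fromℕ 0
  pathLength (u ∷ [])     = fromℕ 0
  pathLength (u ∷ v ∷ vs) = ∥ u , v ∥ + pathLength (v ∷ vs)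

  pathLengths≢[] : Connected G → ∀ u v → List.map pathLength (paths G u v) ≢ []
  pathLengths≢[] conn u v = map-≢[] pathLength (paths G u v) (paths≢[] G conn u v)

  π : Connected G → Fin n → Fin n → ℝ
  π conn u v = minimum (List.map pathLength (paths G u v)) (pathLengths≢[] conn u v)

  spanningRatio : Connected G → ℝ
  spanningRatio conn = maximum (List.map (λ (u , v , u≢v) → π conn u v ÷ ∥ u , v ∥ ⟨ distinct u≢v ⟩) (distinctPairs n))

  edgeLengths : List ℝ
  edgeLengths = List.map (λ (u , v , _) → ∥ u , v ∥) (edges G)

  longest : ℝ
  longest = maximum edgeLengths

  edgeLengths≢[] : HasEdge G → edgeLengths ≢ []
  edgeLengths≢[] = map-≢[] _ (edges G)

  edgeLengths-positive : All (fromℕ 0 <_) edgeLengths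
  edgeLengths-positive = All.map⁺ (All.universal (λ (u , v , e) → distinct λ { refl → irrefl e }) (edges G))

  shortest : HasEdge G → ℝ
  shortest ne = minimum edgeLengths (edgeLengths≢[] ne)

  shortest-positive : ∀ ne → fromℕ 0 < shortest ne
  shortest-positive ne = minimum-positive edgeLengths (edgeLengths≢[] ne) edgeLengths-positive

  edgeLengthRatio : HasEdge G → ℝ
  edgeLengthRatio ne = longest ÷ shortest ne ⟨ shortest-positive ne ⟩

{-# OPTIONS --safe #-}

-- Let v have neighbours w₁, …, w_d at distances r₁, …, r_d.  In a tree the only path from
-- wᵢ to wⱼ passes through v, so a spanning ratio of at most s means rᵢ + rⱼ ≤ s ∥wᵢ wⱼ∥.
-- Cut the plane around v into dyadic annuli ρ ≤ r < 2ρ, and each annulus into square cells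
-- of side about ρ / s: two neighbours in one cell would be too close together, so every
-- annulus contains O(s²) neighbours.  Hence there are Ω(d / s²) annuli, and the
-- edge-length ratio is exponential in their number.
--
-- The bound to prove is a negated strict inequality between Cauchy reals, so one may assume
-- the strict inequality and argue at a single sufficiently late index of all the sequences
-- involved, where only rational numbers occur.
module Submission where

open import Data.Nat as ℕ using (ℕ; zero; suc)
import Data.Nat.Properties as ℕ
import Data.Nat.Coprimality as Coprime
open import Data.Integer as ℤ using (+_)
import Data.Integer.Properties as ℤ
open import Data.Rational as ℚ using (ℚ; 0ℚ; 1ℚ; ½)
import Data.Rational.Properties as ℚ
open import Data.Fin as Fin using (Fin; zero; suc; toℕ)
import Data.Fin.Properties as Fin
open import Data.List as List using (List; []; _∷_; _++_)
import Data.List.Properties as List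
open import Data.List.Membership.Propositional using (_∈_)
import Data.List.Membership.Propositional.Properties as ∈
import Data.List.Membership.DecPropositional as Dec∈
open import Data.List.Relation.Unary.All as All using (All; []; _∷_)
import Data.List.Relation.Unary.All.Properties as All
open import Data.List.Relation.Unary.AllPairs using (AllPairs; []; _∷_)
open import Data.List.Relation.Unary.Any as Any using (here; there)
import Data.List.Relation.Unary.Any.Properties as Any
open import Data.List.Relation.Unary.Linked as Linked using (Linked; []; [-]; _∷_)
import Data.List.Relation.Unary.Unique.Propositional.Properties as Unique
open import Data.Maybe as Maybe using (Maybe; just)
import Data.Maybe.Relation.Unary.Any as Maybe∃
open import Data.Product using (Σ; ∃; _×_; _,_; proj₁; proj₂)
open import Data.Sum using (inj₁; inj₂)
open import Data.Empty using (⊥; ⊥-elim)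
open import Relation.Nullary using (¬_; Dec; yes; no)
open import Relation.Nullary.Decidable using (dec⇒maybe; ¬?; toWitness)
open import Relation.Binary.PropositionalEquality
import Defs

-- Rational arithmetic at a fixed index.

module RationalLemmas where

  open Defs.Rationals
  open Defs.CauchyFacts using (root-2^; inv; inv-spec)
  open import Data.Rational
  open import Data.Rational.Properties
  open import Data.Rational.Solver using (module +-*-Solver)
  open +-*-Solver
  import Data.Rational.Unnormalised as ℚᵘ

  fromℕ-* : ∀ m n → fromℕ (m ℕ.* n) ≡ fromℕ m * fromℕ n
  fromℕ-* m n = trans (cong (_/ 1) (ℤ.pos-* m n)) (fromℚᵘ-* (ℚᵘ.mkℚᵘ (+ m) 0) (ℚᵘ.mkℚᵘ (+ n) 0))

  fromℕ-mono : ∀ {m n} → m ℕ.≤ n → fromℕ m ≤ fromℕ n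
  fromℕ-mono {m} {n} h = fromℚᵘ-mono {ℚᵘ.mkℚᵘ (+ m) 0} {ℚᵘ.mkℚᵘ (+ n) 0} (ℚᵘ.*≤* (ℤ.*-monoʳ-≤-nonNeg (+ 1) (ℤ.+≤+ h)))

  0≤fromℕ : ∀ k → 0ℚ ≤ fromℕ k
  0≤fromℕ k = 0≤frac k 0

  fromℕ-suc : ∀ k → fromℕ (suc k) ≡ fromℕ k + 1ℚ
  fromℕ-suc k = frac-suc k 0

  <⇒≱ : ∀ {p q} → p < q → ¬ (q ≤ p)
  <⇒≱ p<q q≤p = <-irrefl refl (<-≤-trans p<q q≤p)

  p≤q⇒0≤q-p : ∀ {p q} → p ≤ q → 0ℚ ≤ q - p
  p≤q⇒0≤q-p {p} {q} h = ≤-cast (sym (+-inverseʳ p)) refl (+-monoˡ-≤ (- p) h)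

  0≤q-p⇒p≤q : ∀ {p q} → 0ℚ ≤ q - p → p ≤ q
  0≤q-p⇒p≤q {p} {q} h = ≤-cast (sym (+-identityʳ p)) (solve 2 (λ p q → q := p :+ (q :- p)) refl p q) (+-monoʳ-≤ p h)

  square-mono : ∀ {p q} → - q ≤ p → p ≤ q → p * p ≤ q * q
  square-mono {p} {q} -q≤p p≤q = 0≤q-p⇒p≤q (≤-cast refl
    (solve 2 (λ p q → q :* q :- p :* p := (q :- p) :* (p :- (:- q))) refl p q)
    (0≤* (p≤q⇒0≤q-p p≤q) (p≤q⇒0≤q-p -q≤p)))

  square-cancel : ∀ {p q} → 0ℚ ≤ q → p * p ≤ q * q → p ≤ q
  square-cancel {p} {q} 0≤q h = ^-cancel 1 0≤q (≤-cast (sq p) (sq q) h)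
    where
    sq : ∀ p → p ^ 2 ≡ p * p
    sq p = cong (p *_) (*-identityʳ p)

  0≤square : ∀ p → 0ℚ ≤ p * p
  0≤square p with ≤-total 0ℚ p
  ... | inj₁ h = 0≤* h h
  ... | inj₂ h = ≤-cast refl (solve 1 (λ p → p :* p := (:- p) :* (:- p)) refl p) (0≤* (neg-antimono-≤ h) (neg-antimono-≤ h))

  +-cancelʳ-< : ∀ r p q → p + r < q + r → p < q
  +-cancelʳ-< r p q h = <-cast (lem p r) (lem q r) (+-monoˡ-< (- r) h)
    where
    lem : ∀ p r → p ≡ p + r - r
    lem = solve 2 (λ p r → p := p :+ r :- r) refl

  ⅕ : ℚ
  ⅕ = + 1 / 5

  -- Both sequences move by less than `δ` between two late indices. A gap below `3δ` at one index is
  -- therefore below `5δ = ε` at the other, while in `tail-above` a gap of at least `3δ` stays above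
  -- `δ`.
  tail-below : ∀ {x x′ y y′ δ ε} → δ ≡ ⅕ * ε → x′ < x + δ → y < y′ + δ → x < y + (δ + δ + δ) → x′ < y′ + ε
  tail-below {x} {x′} {y} {y′} {δ} {ε} refl p q r = <-trans p (<-cast refl
    (solve 2 (λ y e → y :+ e := (y :+ con ⅕ :* e) :+ (con ⅕ :* e :+ con ⅕ :* e :+ con ⅕ :* e) :+ con ⅕ :* e) refl y′ ε)
    (+-monoˡ-< δ (<-trans r (+-monoˡ-< (δ + δ + δ) q))))

  tail-above : ∀ {x x′ y y′ δ} → x < x′ + δ → y′ < y + δ → y + (δ + δ + δ) ≤ x → y′ + δ < x′
  tail-above {x} {x′} {y} {y′} {δ} p q r = +-cancelʳ-< δ (y′ + δ) x′ (<-trans (+-monoˡ-< δ (+-monoˡ-< δ q)) (≤-<-trans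
    (≤-cast (solve 2 (λ y d → y :+ d :+ d :+ d := y :+ (d :+ d :+ d)) refl y δ) refl r) p))

  -- The first `k` with `x < f (suc k)` works. This one search finds integer parts, dyadic annuli
  -- and grid columns.
  bucket : ∀ (f : ℕ → ℚ) N {x} → f 0 ≤ x → x < f N →
           ∃ λ (k : Fin N) → f (toℕ k) ≤ x × x < f (suc (toℕ k))
  bucket f zero    lo hi = ⊥-elim (<⇒≱ hi lo)
  bucket f (suc N) {x} lo hi with x <? f 1
  ... | yes x<f1 = zero , lo , x<f1
  ... | no  x≮f1 = let k , p , q = bucket (λ k → f (suc k)) N (≮⇒≥ x≮f1) hi in suc k , p , q

  natural-part : ∀ {p} → 0ℚ ≤ p → ∃ λ k → fromℕ k ≤ p × p < fromℕ (suc k)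
  natural-part {p} 0≤p =
    let k , lo , hi = bucket fromℕ (suc ℤ.∣ ↥ p ∣) 0≤p
                        (<-cast refl (fromℕ-suc ℤ.∣ ↥ p ∣) (≤-<-trans (≤fromℕ p) (p<p+q 0<1)))
    in toℕ k , lo , hi

  root-2^-≤ : ∀ n p K → p ≤ fromℕ K → root-2^ n p ≤ fromℕ 2 ^ suc K
  root-2^-≤ n p@(mkℚ i a _) K p≤K = ≤-cast refl (*-comm (fromℕ 2) (fromℕ 2 ^ K))
    -- At precision `M = 0` the factor `1 + unit M` is 2, which accounts for the extra power of 2 in
    -- the bound.
    (2^-close i (+ K) a 0 0 (0≤root (suc a) n (2^ℤ i)) (0≤^ K (<⇒≤ 0<2))
      (proj₁ (root-spec a n (0≤2^ℤ i))) (≤-reflexive (sym (*-identityʳ (fromℕ 2 ^ K))))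
      (≤-cross p q 0 (≤-trans (≤-cast refl (sym (↥p/↧p≡p q)) p≤K) (p≤p+q 0≤1))))
    where
    q : ℚ
    -- `K` as an explicit reduced fraction, so that the numerator and denominator in `≤-cross`
    -- compute to `+ K` and 1.
    q = mkℚ (+ K) 0 (Coprime.sym (Coprime.1-coprimeTo K))

  -- Packing: annuli and square cells.

  grid : ℚ → ℚ → ℕ → ℚ
  grid a w j = a + fromℕ j * w

  grid-suc : ∀ a w j → grid a w (suc j) ≡ grid a w j + w
  grid-suc a w j = trans (cong (λ z → a + z * w) (fromℕ-suc j))
    (solve 3 (λ a w f → a :+ (f :+ con 1ℚ) :* w := a :+ f :* w :+ w) refl a w (fromℕ j))

  same-cell : ∀ a w j {x y} → grid a w j ≤ x → x < grid a w (suc j) → grid a w j ≤ y → y < grid a w (suc j) →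
              (x - y) * (x - y) ≤ w * w
  same-cell a w j {x} {y} x≥ x< y≥ y< = square-mono
    (≤-cast (solve 2 (λ w y → :- w := (y :- w) :- y) refl w y) refl (+-monoˡ-≤ (- y) (step y< x≥)))
    (≤-cast refl (solve 2 (λ w y → w := (w :+ y) :- y) refl w y) (+-monoˡ-≤ (- y)
      (≤-cast (solve 2 (λ x w → x := w :+ (x :- w)) refl x w) refl (+-monoʳ-≤ w (step x< y≥)))))
    where
    step : ∀ {x y} → x < grid a w (suc j) → grid a w j ≤ y → x - w ≤ y
    step {x} h k = ≤-trans (≤-cast refl
        (trans (solve 2 (λ g w → g := g :+ w :- w) refl (grid a w j) w) (cong (_- w) (sym (grid-suc a w j))))
        (+-monoˡ-≤ (- w) (<⇒≤ h))) k

  module _ (S : ℕ) (K : ℕ) {m : ℚ} (0<m : 0ℚ < m) where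

    private
      radius : ℕ → ℚ
      radius k = fromℕ 2 ^ k * m

      0<radius : ∀ k → 0ℚ < radius k
      0<radius k = 0<* (0<^ k 0<2) 0<m

      radius-suc : ∀ k → radius (suc k) ≡ fromℕ 2 * radius k
      radius-suc k = *-assoc (fromℕ 2) (fromℕ 2 ^ k) m

      -- In the annulus `ρ ≤ r < 2ρ` the coordinates are at most `2r < 4ρ` in absolute value. The
      -- grid therefore runs from `-4ρ` to `4ρ`, which takes `8 (S + 1)` steps of width
      -- `ρ / (S + 1)`.
      corner width : ℚ → ℚ
      corner ρ = - (fromℕ 4 * ρ)
      width ρ = ρ * unit S

      cells : ℕ
      cells = suc S ℕ.* 8

      grid-0 : ∀ ρ → grid (corner ρ) (width ρ) 0 ≡ corner ρ
      grid-0 ρ = solve 2 (λ c w → c :+ con 0ℚ :* w := c) refl (corner ρ) (width ρ)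

      grid-end : ∀ ρ → grid (corner ρ) (width ρ) cells ≡ fromℕ 4 * ρ
      grid-end ρ = trans (solve 3 (λ ρ f u → :- (con (fromℕ 4) :* ρ) :+ f :* (ρ :* u) := :- (con (fromℕ 4) :* ρ) :+ ρ :* (f :* u)) refl ρ (fromℕ cells) (unit S))
        (trans (cong (λ z → corner ρ + ρ * z) (trans (sym (frac≡ cells S)) (frac-full 8 S)))
          (solve 1 (λ ρ → :- (con (fromℕ 4) :* ρ) :+ ρ :* con (fromℕ 8) := con (fromℕ 4) :* ρ) refl ρ))

      locate : ∀ {ρ r} x → 0ℚ ≤ r → r < fromℕ 2 * ρ → x * x ≤ (fromℕ 2 * r) * (fromℕ 2 * r) →
               ∃ λ (j : Fin cells) → grid (corner ρ) (width ρ) (toℕ j) ≤ x × x < grid (corner ρ) (width ρ) (suc (toℕ j))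
      locate {ρ} {r} x 0≤r r<2ρ x²≤ = bucket (grid (corner ρ) (width ρ)) cells
        (≤-cast (grid-0 ρ) (solve 1 (λ x → x := :- (:- x)) refl x)
          (neg-antimono-≤ (<⇒≤ (≤-<-trans (square-cancel 0≤2r (≤-cast (solve 1 (λ x → (:- x) :* (:- x) := x :* x) refl x) refl x²≤)) 2r<4ρ))))
        (<-cast refl (grid-end ρ) (≤-<-trans (square-cancel 0≤2r x²≤) 2r<4ρ))
        where
        0≤2r : 0ℚ ≤ fromℕ 2 * r
        0≤2r = 0≤* (<⇒≤ 0<2) 0≤r
        2r<4ρ : fromℕ 2 * r < fromℕ 4 * ρ
        2r<4ρ = <-cast refl (solve 1 (λ ρ → con (fromℕ 4) :* ρ := con (fromℕ 2) :* (con (fromℕ 2) :* ρ)) refl ρ) (*-monoʳ-< 0<2 r<2ρ)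

      -- Separation would give `4ρ² ≤ (r + r′)² ≤ (S + 1)² (x + y)`, but two squared coordinate
      -- differences within one cell sum to at most `2ρ² / (S + 1)²`.
      too-close : ∀ {ρ r r′ x y} → 0ℚ < ρ → ρ ≤ r → ρ ≤ r′ → x ≤ width ρ * width ρ → y ≤ width ρ * width ρ →
                  ¬ ((r + r′) * (r + r′) ≤ fromℕ (suc S) * fromℕ (suc S) * (x + y))
      too-close {ρ} {r} {r′} {x} {y} 0<ρ ρ≤r ρ≤r′ x≤ y≤ h = <⇒≱ 2ρ²<4ρ² (≤-trans lower (≤-trans h upper))
        where
        F = fromℕ (suc S)
        F*unit : F * unit S ≡ 1ℚ
        F*unit = trans (sym (frac≡ (suc S) S)) (frac-self S)
        0≤2ρ : 0ℚ ≤ ρ + ρ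
        0≤2ρ = +-mono-≤ (<⇒≤ 0<ρ) (<⇒≤ 0<ρ)
        lower : (ρ + ρ) * (ρ + ρ) ≤ (r + r′) * (r + r′)
        lower = *-mono 0≤2ρ (≤-trans 0≤2ρ (+-mono-≤ ρ≤r ρ≤r′)) (+-mono-≤ ρ≤r ρ≤r′) (+-mono-≤ ρ≤r ρ≤r′)
        upper : F * F * (x + y) ≤ ρ * ρ + ρ * ρ
        upper = ≤-trans (*-monoˡ-≤-nonNeg (F * F) {{nonNegative (0≤square F)}} (+-mono-≤ x≤ y≤))
          (≤-reflexive (trans (solve 3 (λ f ρ u → f :* f :* (ρ :* u :* (ρ :* u) :+ ρ :* u :* (ρ :* u)) := (ρ :* ρ :+ ρ :* ρ) :* ((f :* u) :* (f :* u))) refl F ρ (unit S))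
            (trans (cong (λ z → (ρ * ρ + ρ * ρ) * (z * z)) F*unit) (*-identityʳ (ρ * ρ + ρ * ρ)))))
        2ρ²<4ρ² : ρ * ρ + ρ * ρ < (ρ + ρ) * (ρ + ρ)
        2ρ²<4ρ² = <-cast refl (solve 1 (λ ρ → (ρ :+ ρ) :* (ρ :+ ρ) := (ρ :* ρ :+ ρ :* ρ) :+ (ρ :* ρ :+ ρ :* ρ)) refl ρ)
          (p<p+q (+-mono-< (0<* 0<ρ 0<ρ) (0<* 0<ρ 0<ρ)))

    -- Dyadic annuli, each cut into square cells of side ρ / (S + 1), where ρ is the
    -- inner radius: separated points lie in different cells.
    separated⇒few : ∀ {d} (r X Y : Fin d → ℚ) →
      (∀ i → m ≤ r i) → (∀ i → r i < fromℕ 2 ^ K * m) →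
      (∀ i → X i * X i + Y i * Y i ≤ (fromℕ 2 * r i) * (fromℕ 2 * r i)) →
      (∀ i j → i ≢ j → (r i + r j) * (r i + r j) ≤
        fromℕ (suc S) * fromℕ (suc S) * ((X i - X j) * (X i - X j) + (Y i - Y j) * (Y i - Y j))) →
      d ℕ.≤ K ℕ.* (cells ℕ.* cells)
    separated⇒few {d} r X Y m≤r r< bound sep with d ℕ.≤? K ℕ.* (cells ℕ.* cells)
    ... | yes p = p
    ... | no ¬p = ⊥-elim (clash (Fin.pigeonhole (ℕ.≰⇒> ¬p) code))
      where
      annulus : ∀ i → ∃ λ (k : Fin K) → radius (toℕ k) ≤ r i × r i < radius (suc (toℕ k))
      annulus i = bucket radius K (≤-cast (*-identityˡ m) refl (m≤r i)) (r< i)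

      k : Fin d → Fin K
      k i = proj₁ (annulus i)

      ρ : Fin d → ℚ
      ρ i = radius (toℕ (k i))

      cell : ∀ i x → x * x ≤ (fromℕ 2 * r i) * (fromℕ 2 * r i) → _
      cell i x = locate {ρ i} {r i} x (≤-trans (<⇒≤ 0<m) (m≤r i)) (<-cast refl (sym (radius-suc (toℕ (k i)))) (proj₂ (proj₂ (annulus i))))

      cellˣ : ∀ i → _
      cellˣ i = cell i (X i) (≤-trans (p≤p+q (0≤square (Y i))) (bound i))

      cellʸ : ∀ i → _
      cellʸ i = cell i (Y i) (≤-trans (≤-cast refl (+-comm (X i * X i) (Y i * Y i)) (p≤p+q (0≤square (X i)))) (bound i))

      code : Fin d → Fin (K ℕ.* (cells ℕ.* cells))
      code i = Fin.combine (k i) (Fin.combine (proj₁ (cellˣ i)) (proj₁ (cellʸ i)))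

      -- Generalised over the indices because the equalities extracted from equal codes can be
      -- matched with `refl` only between variables.
      near : ∀ {k k′ : Fin K} {j j′ : Fin cells} {x x′} → k ≡ k′ → j ≡ j′ → let ρ = radius (toℕ k); ρ′ = radius (toℕ k′) in
        grid (corner ρ) (width ρ) (toℕ j) ≤ x × x < grid (corner ρ) (width ρ) (suc (toℕ j)) →
        grid (corner ρ′) (width ρ′) (toℕ j′) ≤ x′ × x′ < grid (corner ρ′) (width ρ′) (suc (toℕ j′)) →
        (x - x′) * (x - x′) ≤ width ρ * width ρ
      near {k} {j = j} refl refl (p , q) (p′ , q′) = same-cell (corner (radius (toℕ k))) (width (radius (toℕ k))) (toℕ j) p q p′ q′

      clash : ¬ (∃ λ i → ∃ λ j → i Fin.< j × code i ≡ code j)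
      clash (i , j , i<j , e) =
        let k≡ , c≡   = Fin.combine-injective (k i) _ (k j) _ e
            jˣ≡ , jʸ≡ = Fin.combine-injective (proj₁ (cellˣ i)) (proj₁ (cellʸ i)) (proj₁ (cellˣ j)) (proj₁ (cellʸ j)) c≡
        in too-close {ρ i} {r i} {r j} (0<radius (toℕ (k i))) (proj₁ (proj₂ (annulus i)))
             (≤-cast (cong (λ k → radius (toℕ k)) k≡) refl (proj₁ (proj₂ (annulus j))))
             (near k≡ jˣ≡ (proj₂ (cellˣ i)) (proj₂ (cellˣ j)))
             (near k≡ jʸ≡ (proj₂ (cellʸ i)) (proj₂ (cellʸ j)))
             (sep i j (Fin.<⇒≢ i<j))

  -- Quotients, squares and the final count.

  ÷-≤ : ∀ {p q t} → 0ℚ < q → p * inv q ≤ t → p ≤ t * q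
  ÷-≤ {p} {q} {t} 0<q h = ≤-cast (trans (sym (*-identityʳ p)) (trans (cong (p *_) (sym (inv-spec 0<q)))
      (solve 3 (λ p q i → p :* (q :* i) := p :* i :* q) refl p q (inv q)))) refl
    (*-monoʳ-≤-nonNeg q {{nonNegative (<⇒≤ 0<q)}} h)

  ÷-< : ∀ {p q t} → 0ℚ < q → p * inv q < t → p < t * q
  ÷-< {p} {q} {t} 0<q h = ≤-<-trans (÷-≤ 0<q ≤-refl) (*-monoˡ-<-pos q {{positive 0<q}} h)

  product-square : ∀ {p f q g} → 0ℚ ≤ p → 0ℚ ≤ f → 0ℚ ≤ q → p ≤ f * q → q * q ≤ g → p * p ≤ f * f * g
  product-square {p} {f} {q} {g} 0≤p 0≤f 0≤q p≤ q²≤ = ≤-trans (*-mono 0≤p (0≤* 0≤f 0≤q) p≤ p≤)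
    (≤-cast (solve 2 (λ f q → f :* q :* (f :* q) := f :* f :* (q :* q)) refl f q) refl
      (*-monoˡ-≤-nonNeg (f * f) {{nonNegative (0≤square f)}} q²≤))

  -- Absorbs the rounding of square roots: `e` is the precision at the current index, and `e ≤ r`
  -- turns the additive error into a factor 2.
  doubled-square : ∀ {r e g} → 0ℚ ≤ r → 0ℚ ≤ e → e ≤ r → g ≤ (r + e) * (r + e) → g ≤ (fromℕ 2 * r) * (fromℕ 2 * r)
  doubled-square {r} {e} 0≤r 0≤e e≤r h = ≤-trans h
    (*-mono (+-mono-≤ 0≤r 0≤e) (0≤* (<⇒≤ 0<2) 0≤r) r+e≤2r r+e≤2r)
    where
    r+e≤2r : r + e ≤ fromℕ 2 * r
    r+e≤2r = ≤-cast refl (solve 1 (λ r → con (fromℕ 2) :* r := r :+ r) refl r) (+-monoʳ-≤ r e≤r)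

  ≤-from-<+1 : ∀ k u → fromℕ (suc k) < u + 1ℚ → fromℕ k ≤ u
  ≤-from-<+1 k u h = <⇒≤ (+-cancelʳ-< 1ℚ (fromℕ k) u (<-cast (sym (fromℕ-suc k)) refl h))

  half-bound : ∀ σ → 1ℚ < σ + ½ → ½ ≤ σ
  half-bound σ h = <⇒≤ (+-cancelʳ-< ½ ½ σ h)

  translate : ∀ v a b → (v - a) - (v - b) ≡ b - a
  translate = solve 3 (λ v a b → (v :- a) :- (v :- b) := b :- a) refl

  -- The constant in the exponent. Twice it is `1/2000`, and `40² / 2000 = 4/5` is still below 1,
  -- which is what the count of cells requires.
  rate : ℚ
  rate = + 1 / 4000

  -- With u = d / σ² the annuli number at most u / 2000 and each has at most
  -- (40 σ)² cells, which leaves room for fewer than d points.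
  too-few-cells : ∀ d S k σ → ½ ≤ σ → fromℕ 8000 ≤ fromℕ d * inv (σ * σ) →
    fromℕ k ≤ rate * (fromℕ d * inv (σ * σ)) → fromℕ S ≤ σ + 1ℚ →
    ¬ (d ℕ.≤ suc (suc k) ℕ.* (suc S ℕ.* 8 ℕ.* (suc S ℕ.* 8)))
  too-few-cells d S k σ ½≤σ u≥ k≤ S≤ d≤ = <⇒≱ strict (≤-trans (fromℕ-mono d≤) count)
    where
    u : ℚ
    u = fromℕ d * inv (σ * σ)
    0<σ : 0ℚ < σ
    0<σ = <-≤-trans (positive⁻¹ ½) ½≤σ
    0<u : 0ℚ < u
    0<u = <-≤-trans (positive⁻¹ (fromℕ 8000)) u≥
    0<uσ² : 0ℚ < u * (σ * σ)
    0<uσ² = 0<* 0<u (0<* 0<σ 0<σ)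
    d≡ : u * (σ * σ) ≡ fromℕ d
    d≡ = trans (solve 3 (λ d i s → d :* i :* s := d :* (s :* i)) refl (fromℕ d) (inv (σ * σ)) (σ * σ))
      (trans (cong (fromℕ d *_) (inv-spec (0<* 0<σ 0<σ))) (*-identityʳ (fromℕ d)))
    -- The two additional annuli are paid for by `rate * u`, which is at least 2 because `u ≥ 8000`.
    K≤ : fromℕ (suc (suc k)) ≤ (+ 1 / 2000) * u
    K≤ = ≤-cast (trans (fromℕ-suc (suc k)) (trans (cong (_+ 1ℚ) (fromℕ-suc k)) (solve 1 (λ f → f :+ con 1ℚ :+ con 1ℚ := f :+ con (fromℕ 2)) refl (fromℕ k))))
                (solve 1 (λ u → con (+ 1 / 2000) :* u := con rate :* u :+ con rate :* u) refl u)
                (+-mono-≤ k≤ (*-monoˡ-≤-nonNeg rate u≥))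
    -- `8 (S + 1) ≤ 8 (σ + 2) ≤ 8 (σ + 4σ)`, using `½ ≤ σ`.
    G≤ : fromℕ (suc S ℕ.* 8) ≤ fromℕ 40 * σ
    G≤ = ≤-cast (trans (fromℕ-* (suc S) 8) (cong (_* fromℕ 8) (fromℕ-suc S))) (solve 1 (λ s → con (fromℕ 40) :* s := (s :+ con (fromℕ 4) :* s) :* con (fromℕ 8)) refl σ)
      (*-monoʳ-≤-nonNeg (fromℕ 8) (≤-trans (+-monoˡ-≤ 1ℚ S≤) (≤-cast (+-assoc σ 1ℚ 1ℚ) refl (+-monoʳ-≤ σ (*-monoˡ-≤-nonNeg (fromℕ 4) ½≤σ)))))
    count : fromℕ (suc (suc k) ℕ.* (suc S ℕ.* 8 ℕ.* (suc S ℕ.* 8))) ≤ (+ 4 / 5) * (u * (σ * σ))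
    count = ≤-cast (trans (fromℕ-* (suc (suc k)) (suc S ℕ.* 8 ℕ.* (suc S ℕ.* 8))) (cong (fromℕ (suc (suc k)) *_) (fromℕ-* (suc S ℕ.* 8) (suc S ℕ.* 8))))
                   (solve 2 (λ u s → con (+ 4 / 5) :* (u :* (s :* s)) := con (+ 1 / 2000) :* u :* (con (fromℕ 40) :* s :* (con (fromℕ 40) :* s))) refl u σ)
                   (*-mono (0≤fromℕ (suc (suc k))) (0≤square (fromℕ 40 * σ)) K≤ (*-mono (0≤fromℕ (suc S ℕ.* 8)) (≤-trans (0≤fromℕ (suc S ℕ.* 8)) G≤) G≤ G≤))
    strict : (+ 4 / 5) * (u * (σ * σ)) < fromℕ d
    strict = <-cast refl (trans (sym d≡) (solve 1 (λ x → x := con (+ 4 / 5) :* x :+ con (+ 1 / 5) :* x) refl (u * (σ * σ))))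
      (p<p+q (0<* (positive⁻¹ (+ 1 / 5)) 0<uσ²))

open import Defs
open CauchyFacts using (both; from; inv; root-2^)
open Rationals using (unit; root; root-spec; 0≤root; archimedean; unit-antimono; ≤-cast)
open RationalLemmas

-- From Cauchy reals to late indices.

Eventually : (ℕ → Set) → Set
Eventually P = ∃ λ N → ∀ n → N ℕ.≤ n → P n

_∧_ : ∀ {P Q : ℕ → Set} → Eventually P → Eventually Q → Eventually (λ n → P n × Q n)
(N , p) ∧ (M , q) = N ℕ.⊔ M , λ n n≥ → p n (proj₁ (both {N} n≥)) , q n (proj₂ (both {N} n≥))

eventually-∀ : ∀ {k} {P : Fin k → ℕ → Set} → (∀ i → Eventually (P i)) → Eventually (λ n → ∀ i → P i n)
eventually-∀ {zero}  p = 0 , λ _ _ ()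
eventually-∀ {suc k} p =
  let N , h = p zero ∧ eventually-∀ (λ i → p (suc i))
  in N , λ n n≥ → λ { zero → proj₁ (h n n≥) ; (suc i) → proj₂ (h n n≥) i }

-- Although `≤` is a negation, a rational comparison at one index `L` past both Cauchy thresholds is
-- decidable. If `x` exceeds `y` there by at least `3δ`, then `y < x`, a contradiction; otherwise
-- all later indices obey the bound.
≤⇒eventually : ∀ x y → x ≤ y → ∀ ε → 0ℚ ℚ.< ε → Eventually (λ n → seq x n ℚ.< seq y n ℚ.+ ε)
≤⇒eventually x y x≤y ε 0<ε = go (from {seq x} (cauchy x) δ 0<δ) (from {seq y} (cauchy y) δ 0<δ)
  where
  δ : ℚ
  δ = ⅕ ℚ.* ε
  0<δ : 0ℚ ℚ.< δ
  0<δ = Rationals.0<* (ℚ.positive⁻¹ ⅕) 0<ε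
  Close : (ℕ → ℚ) → Set
  Close z = ∃ λ N → ∀ m n → N ℕ.≤ m → N ℕ.≤ n → z m ℚ.< z n ℚ.+ δ
  go : Close (seq x) → Close (seq y) → Eventually (λ n → seq x n ℚ.< seq y n ℚ.+ ε)
  go (N , h) (M , k) = decide (seq y L ℚ.+ (δ ℚ.+ δ ℚ.+ δ) ℚ.≤? seq x L)
    where
    L = N ℕ.⊔ M
    N≤ = ℕ.m≤m⊔n N M
    M≤ = ℕ.m≤n⊔m N M
    decide : Dec (seq y L ℚ.+ (δ ℚ.+ δ ℚ.+ δ) ℚ.≤ seq x L) → Eventually (λ n → seq x n ℚ.< seq y n ℚ.+ ε)
    decide (yes p) = ⊥-elim (x≤y (δ , 0<δ , L , λ n n≥ →
      tail-above {seq x L} {seq x n} {seq y L} {seq y n} {δ} (h L n N≤ (proj₁ (both {N} n≥))) (k n L (proj₂ (both {N} n≥)) M≤) p))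
    decide (no ¬p) = L , λ n n≥ →
      tail-below {seq x L} {seq x n} {seq y L} {seq y n} {δ} refl (h n L (proj₁ (both {N} n≥)) N≤) (k L n M≤ (proj₂ (both {N} n≥))) (ℚ.≰⇒> ¬p)

-- The lower bound is `unit n` because this is the rounding error of `root` at index `n`; positive
-- lengths eventually dominate that error.
0<⇒eventually : ∀ x → fromℕ 0 < x → Eventually (λ n → unit n ℚ.≤ seq x n)
0<⇒eventually x (ε , 0<ε , N , h) =
  let M , unit≤ε = archimedean 0<ε
  in N ℕ.⊔ M , λ n n≥ → ℚ.≤-trans (unit-antimono (proj₂ (both {N} n≥))) (ℚ.≤-trans unit≤ε
       (≤-cast (sym (ℚ.+-identityˡ ε)) refl (ℚ.<⇒≤ (h n (proj₁ (both {N} n≥))))))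

-- Maxima and minima, index by index.

maximum-upper : ∀ {x xs} → x ∈ xs → ∀ n → seq x n ℚ.≤ seq (maximum xs) n
maximum-upper {xs = y ∷ ys} (here refl) n = ℚ.p≤p⊔q (seq y n) (seq (maximum ys) n)
maximum-upper {xs = y ∷ ys} (there x∈) n = ℚ.≤-trans (maximum-upper x∈ n) (ℚ.p≤q⊔p (seq y n) (seq (maximum ys) n))

maximum-map-upper : ∀ {A : Set} (f : A → ℝ) {a as} → a ∈ as → ∀ n → seq (f a) n ℚ.≤ seq (maximum (List.map f as)) n
maximum-map-upper f {a} {as} a∈ = maximum-upper {f a} {List.map f as} (∈.∈-map⁺ f a∈)

minimum-lower : ∀ {x xs} ne → x ∈ xs → ∀ n → seq (minimum xs ne) n ℚ.≤ seq x n
minimum-lower {x} {z ∷ zs} _ x∈ n = go zs x∈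
  where
  go : ∀ ys → x ∈ z ∷ ys → seq (List.foldr _⊓_ z ys) n ℚ.≤ seq x n
  go []       (here refl) = ℚ.≤-refl
  go (y ∷ ys) (here refl) = ℚ.≤-trans (ℚ.p⊓q≤q (seq y n) (seq (List.foldr _⊓_ z ys) n)) (go ys (here refl))
  go (y ∷ ys) (there (here refl)) = ℚ.p⊓q≤p (seq y n) (seq (List.foldr _⊓_ z ys) n)
  go (y ∷ ys) (there (there x∈)) = ℚ.≤-trans (ℚ.p⊓q≤q (seq y n) (seq (List.foldr _⊓_ z ys) n)) (go ys (there x∈))
minimum-lower {xs = []} ne _ n = ⊥-elim (ne refl)

minimum-greatest : ∀ {b xs n} ne → All (λ x → b ℚ.≤ seq x n) xs → b ℚ.≤ seq (minimum xs ne) n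
minimum-greatest {xs = []} ne _ = ⊥-elim (ne refl)
minimum-greatest {b} {z ∷ zs} {n} _ (p ∷ ps) = go zs ps
  where
  go : ∀ ys → All (λ x → b ℚ.≤ seq x n) ys → b ℚ.≤ seq (List.foldr _⊓_ z ys) n
  go []       []       = p
  go (y ∷ ys) (q ∷ qs) = ℚ.⊓-glb q (go ys qs)

-- Distances at a fixed index.

gap² : Point → Point → ℕ → ℚ
gap² (x , y) (x′ , y′) n = (seq x n ℚ.- seq x′ n) ℚ.* (seq x n ℚ.- seq x′ n) ℚ.+ (seq y n ℚ.- seq y′ n) ℚ.* (seq y n ℚ.- seq y′ n)

0≤gap² : ∀ P Q n → 0ℚ ℚ.≤ gap² P Q n
0≤gap² (x , y) (x′ , y′) n = ℚ.+-mono-≤ (0≤square (seq x n ℚ.- seq x′ n)) (0≤square (seq y n ℚ.- seq y′ n))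

-- The truncation at 0 inside `√_` has no effect on a sum of squares.
dist-≡ : ∀ P Q n → seq (dist P Q) n ≡ root 2 n (gap² P Q n)
dist-≡ P Q n = cong (root 2 n) (ℚ.p≥q⇒p⊔q≡p (0≤gap² P Q n))

0≤dist : ∀ P Q n → 0ℚ ℚ.≤ seq (dist P Q) n
0≤dist P Q n = ≤-cast refl (dist-≡ P Q n) (0≤root 2 n (gap² P Q n))

-- `root` rounds down, so this direction is free of error; the converse `gap²≤[dist+unit]²` pays
-- `unit n`.
dist²≤gap² : ∀ P Q n → seq (dist P Q) n ℚ.* seq (dist P Q) n ℚ.≤ gap² P Q n
dist²≤gap² P Q n = ≤-cast (trans (cong (λ z → z ℚ.* z) (dist-≡ P Q n)) (cong (root 2 n (gap² P Q n) ℚ.*_) (sym (ℚ.*-identityʳ (root 2 n (gap² P Q n)))))) refl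
  (proj₁ (root-spec 1 n (0≤gap² P Q n)))

gap²≤[dist+unit]² : ∀ P Q n → let r = seq (dist P Q) n ℚ.+ unit n in gap² P Q n ℚ.≤ r ℚ.* r
gap²≤[dist+unit]² P Q n = ≤-cast refl
  (trans (cong (λ z → (z ℚ.+ unit n) ℚ.* (z ℚ.+ unit n)) (dist-≡ P Q n)) (cong ((root 2 n (gap² P Q n) ℚ.+ unit n) ℚ.*_) (sym (ℚ.*-identityʳ (root 2 n (gap² P Q n) ℚ.+ unit n)))))
  (ℚ.<⇒≤ (proj₂ (root-spec 1 n (0≤gap² P Q n))))

dist-sym : ∀ P Q n → seq (dist P Q) n ≡ seq (dist Q P) n
dist-sym P@(x , y) Q@(x′ , y′) n = trans (dist-≡ P Q n) (trans (cong (root 2 n) (lem (seq x n) (seq x′ n) (seq y n) (seq y′ n))) (sym (dist-≡ Q P n)))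
  where
  open import Data.Rational.Solver using (module +-*-Solver)
  open +-*-Solver
  lem : ∀ a b c d → (a ℚ.- b) ℚ.* (a ℚ.- b) ℚ.+ (c ℚ.- d) ℚ.* (c ℚ.- d) ≡ (b ℚ.- a) ℚ.* (b ℚ.- a) ℚ.+ (d ℚ.- c) ℚ.* (d ℚ.- c)
  lem = solve 4 (λ a b c d → (a :- b) :* (a :- b) :+ (c :- d) :* (c :- d) := (b :- a) :* (b :- a) :+ (d :- c) :* (d :- c)) refl

-- Enumerated pairs and splitting of lists.

∈-mapMaybe⁺ : ∀ {A B : Set} (f : A → Maybe B) {x y xs} → x ∈ xs → f x ≡ just y → y ∈ List.mapMaybe f xs
∈-mapMaybe⁺ f {xs = xs} x∈ eq = Any.mapMaybe⁺ f xs (Any.map (λ e → subst (Maybe∃.Any _) (trans (sym eq) e) (Maybe∃.just refl)) (∈.∈-map⁺ f x∈))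

module _ {n} {P : Fin n → Fin n → Set} (P? : ∀ u v → Dec (P u v)) where

  -- The selection used by both `edges` and `distinctPairs`, so that one membership lemma serves the
  -- two.
  select : Fin n × Fin n → Maybe (∃ λ u → ∃ λ v → P u v)
  select (u , v) = Maybe.map (λ e → u , v , e) (dec⇒maybe (P? u v))

  -- The evidence `e` is existential: the list holds the proof found by `P?`, which may differ from
  -- the given one.
  ∈-pairs : ∀ u v → P u v →
    ∃ λ e → (u , v , e) ∈ List.mapMaybe select (List.cartesianProduct (List.allFin n) (List.allFin n))
  ∈-pairs u v Puv =
    let e , eq = decided (P? u v)
    in e , ∈-mapMaybe⁺ select (∈.∈-cartesianProduct⁺ (∈.∈-allFin u) (∈.∈-allFin v)) (cong (Maybe.map (λ e → u , v , e)) eq)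
    where
    decided : (d : Dec (P u v)) → ∃ λ e → dec⇒maybe d ≡ just e
    decided (yes e) = e , refl
    decided (no ¬e) = ⊥-elim (¬e Puv)

module _ {A : Set} where

  last-++ : ∀ xs (v : A) ys → List.last (xs ++ v ∷ ys) ≡ List.last (v ∷ ys)
  last-++ []           v ys = refl
  last-++ (x ∷ [])     v ys = refl
  last-++ (x ∷ y ∷ xs) v ys = last-++ (y ∷ xs) v ys

  head-++ : ∀ xs (v : A) ys → List.head (xs ++ v ∷ ys) ≡ List.head (xs List.∷ʳ v)
  head-++ []       v ys = refl
  head-++ (x ∷ xs) v ys = refl

  linked-++⁻ˡ : ∀ {R : A → A → Set} xs {ys} → Linked R (xs ++ ys) → Linked R xs
  linked-++⁻ˡ []           _       = []
  linked-++⁻ˡ (x ∷ [])     _       = [-]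
  linked-++⁻ˡ (x ∷ y ∷ xs) (r ∷ l) = r ∷ linked-++⁻ˡ (y ∷ xs) l

  linked-++⁻ʳ : ∀ {R : A → A → Set} xs {ys} → Linked R (xs ++ ys) → Linked R ys
  linked-++⁻ʳ []       l = l
  linked-++⁻ʳ (x ∷ xs) l = linked-++⁻ʳ xs (Linked.tail l)

  allPairs-++⁻ˡ : ∀ {R : A → A → Set} xs {ys} → AllPairs R (xs ++ ys) → AllPairs R xs
  allPairs-++⁻ˡ []       _        = []
  allPairs-++⁻ˡ (x ∷ xs) (r ∷ rs) = All.++⁻ˡ xs r ∷ allPairs-++⁻ˡ xs rs

  allPairs-++⁻ʳ : ∀ {R : A → A → Set} xs {ys} → AllPairs R (xs ++ ys) → AllPairs R ys
  allPairs-++⁻ʳ []       rs       = rs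
  allPairs-++⁻ʳ (x ∷ xs) (_ ∷ rs) = allPairs-++⁻ʳ xs rs

-- Paths in acyclic graphs.

module _ {n} {G : Graph n} (acyclic : Acyclic G) where

  open Graph G

  -- A path with three or more vertices would close to a cycle through the edge `b ~ a`.
  path-between-adjacent : ∀ {a b p} → IsPath G a b p → b ~ a → p ≡ a ∷ b ∷ []
  path-between-adjacent {p = []}            (_ , _ , () , _)      _
  path-between-adjacent {p = x ∷ []}        (_ , _ , refl , refl) e = ⊥-elim (irrefl e)
  path-between-adjacent {p = x ∷ y ∷ []}    (_ , _ , refl , refl) _ = refl
  path-between-adjacent {p = x ∷ y ∷ z ∷ p} path e = ⊥-elim (acyclic path (ℕ.s≤s (ℕ.s≤s (ℕ.s≤s ℕ.z≤n))) e)

  -- If the path avoids `v`, prepending `v` gives a path that the edge `b ~ v` closes to a cycle.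
  -- Otherwise, cutting it at `v` leaves two paths between adjacent vertices, each a single edge.
  path-between-neighbours : ∀ {v a b p} → v ~ a → v ~ b → a ≢ b → IsPath G a b p → p ≡ a ∷ v ∷ b ∷ []
  path-between-neighbours {v} {a} {b} {p} va vb a≢b path@(linked , unique , head , last) with Dec∈._∈?_ Fin._≟_ v p
  ... | no v∉p = ⊥-elim (avoiding p path v∉p)
    where
    avoiding : ∀ p → IsPath G a b p → ¬ (v ∈ p) → ⊥
    avoiding []      (_ , _ , () , _)      _
    avoiding (x ∷ []) (_ , _ , refl , refl) _ = a≢b refl
    avoiding (x ∷ y ∷ p) (linked , unique , refl , last) v∉p =
      acyclic (va ∷ linked , All.¬Any⇒All¬ _ v∉p ∷ unique , refl , last) (ℕ.s≤s (ℕ.s≤s (ℕ.s≤s ℕ.z≤n))) (~-sym vb)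
  ... | yes v∈p with xs , ys , refl ← ∈.∈-∃++ v∈p = cong₂ _++_ xs≡ ys≡
    where
    assoc : xs ++ v ∷ ys ≡ (xs List.∷ʳ v) ++ ys
    assoc = sym (List.++-assoc xs (v ∷ []) ys)
    xs≡ : xs ≡ a ∷ []
    xs≡ = List.∷ʳ-injectiveˡ xs (a ∷ []) (path-between-adjacent
      ( linked-++⁻ˡ (xs List.∷ʳ v) (subst (Linked _~_) assoc linked)
      , allPairs-++⁻ˡ (xs List.∷ʳ v) (subst (AllPairs _≢_) assoc unique)
      , trans (sym (head-++ xs v ys)) head , last-++ xs v []) va)
    ys≡ : v ∷ ys ≡ v ∷ b ∷ []
    ys≡ = path-between-adjacent
      (linked-++⁻ʳ xs linked , allPairs-++⁻ʳ xs unique , refl , trans (sym (last-++ xs v ys)) last) (~-sym vb)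

-- The neighbours of a vertex.

module _ {n} (T : Graph n) (v : Fin n) where

  open Graph T

  -- The same filter as in `degree`, so `Fin (degree T v)` indexes this list definitionally.
  neighbours : List (Fin n)
  neighbours = List.filter (v ~?_) (List.allFin n)

  neighbour : Fin (degree T v) → Fin n
  neighbour = List.lookup neighbours

  neighbour-adjacent : ∀ i → v ~ neighbour i
  neighbour-adjacent i = proj₂ (∈.∈-filter⁻ (v ~?_) {xs = List.allFin n} (∈.∈-lookup {xs = neighbours} i))

  neighbour-injective : ∀ {i j} → neighbour i ≡ neighbour j → i ≡ j
  neighbour-injective = lookup-injective T (Unique.filter⁺ (v ~?_) (Unique.allFin⁺ n))

  degree⇒hasEdge : Fin (degree T v) → HasEdge T
  degree⇒hasEdge i = ∈⇒≢[] (proj₂ (∈-pairs _~?_ v (neighbour i) (neighbour-adjacent i)))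

-- Drawings at a fixed index.

module _ {n} {T : Graph n} (Γ : Drawing T) where

  open Graph T
  open Drawing Γ

  edge∈edgeLengths : ∀ {u x} → u ~ x → ∥_,_∥ Γ u x ∈ edgeLengths Γ
  edge∈edgeLengths {u} {x} e = ∈.∈-map⁺ (λ (u , v , _) → ∥_,_∥ Γ u v) (proj₂ (∈-pairs _~?_ u x e))

  eventually-apart : Eventually (λ k → ∀ a b → a ≢ b → 0ℚ ℚ.< seq (∥_,_∥ Γ a b) k)
  eventually-apart = eventually-∀ λ a → eventually-∀ λ b → apart a b (a Fin.≟ b)
    where
    apart : ∀ a b → Dec (a ≡ b) → Eventually (λ k → a ≢ b → 0ℚ ℚ.< seq (∥_,_∥ Γ a b) k)
    apart a b (yes a≡b) = 0 , λ _ _ a≢b → ⊥-elim (a≢b a≡b)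
    apart a b (no a≢b)  = let N , h = 0<⇒eventually (∥_,_∥ Γ a b) (distinct a≢b) in N , λ k k≥ _ → ℚ.<-≤-trans (Rationals.0<unit k) (h k k≥)

  module _ (connected : Connected T) (acyclic : Acyclic T) where

    -- Every list entering the minimum is the path `a`, `v`, `b`, so every length in it equals the
    -- left-hand side.
    two-edges≤π : ∀ {v a b} → v ~ a → v ~ b → a ≢ b → ∀ k →
      seq (∥_,_∥ Γ v a) k ℚ.+ seq (∥_,_∥ Γ v b) k ℚ.≤ seq (π Γ connected a b) k
    two-edges≤π {v} {a} {b} va vb a≢b k = minimum-greatest {xs = List.map (pathLength Γ) (paths T a b)} {n = k} (pathLengths≢[] Γ connected a b) (All.map⁺ (All.tabulate λ p∈ →
      ℚ.≤-reflexive (trans length≡ (cong (λ p → seq (pathLength Γ p) k)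
        (sym (path-between-neighbours {G = T} acyclic va vb a≢b (proj₂ (∈.∈-filter⁻ (isPath? T a b) {xs = listsUpTo T n} p∈))))))))
      where
      length≡ : seq (∥_,_∥ Γ v a) k ℚ.+ seq (∥_,_∥ Γ v b) k ≡ seq (pathLength Γ (a ∷ v ∷ b ∷ [])) k
      length≡ = cong₂ ℚ._+_ (dist-sym (position v) (position a) k) (sym (ℚ.+-identityʳ (seq (∥_,_∥ Γ v b) k)))

    stretch≤spanningRatio : ∀ {a b} → a ≢ b → ∀ k →
      seq (π Γ connected a b) k ℚ.* inv (seq (∥_,_∥ Γ a b) k) ℚ.≤ seq (spanningRatio Γ connected) k
    stretch≤spanningRatio {a} {b} a≢b =
      maximum-map-upper _ {as = distinctPairs n} (proj₂ (∈-pairs (λ u v → ¬? (u Fin.≟ v)) a b a≢b))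

    -- The whole argument at one index `k`, where `σ` stands for the approximation of `s`. The slack
    -- in `½ ≤ σ` and `σ + 1` is what passing from reals to an index costs.
    module At (v : Fin n) (k : ℕ) (e : HasEdge T) (σ : ℚ)
      (apart    : ∀ a b → a ≢ b → 0ℚ ℚ.< seq (∥_,_∥ Γ a b) k)
      (½≤σ      : ½ ℚ.≤ σ)
      (spanning : seq (spanningRatio Γ connected) k ℚ.≤ σ ℚ.+ 1ℚ)
      (unit≤m   : unit k ℚ.≤ seq (shortest Γ e) k)
      where

      private
        w : Fin (degree T v) → Fin n
        w = neighbour T v

        v~w : ∀ i → v ~ w i
        v~w = neighbour-adjacent T v

        m : ℚ
        m = seq (shortest Γ e) k

        r : Fin (degree T v) → ℚ
        r i = seq (∥_,_∥ Γ v (w i)) k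

        x y : Fin n → ℚ
        x u = seq (proj₁ (position u)) k
        y u = seq (proj₂ (position u)) k

        0<m : 0ℚ ℚ.< m
        0<m = ℚ.<-≤-trans (Rationals.0<unit k) unit≤m

        m≤r : ∀ i → m ℚ.≤ r i
        m≤r i = minimum-lower {∥_,_∥ Γ v (w i)} {edgeLengths Γ} (edgeLengths≢[] Γ e) (edge∈edgeLengths (v~w i)) k

        0≤r : ∀ i → 0ℚ ℚ.≤ r i
        0≤r i = 0≤dist (position v) (position (w i)) k

      -- With `v` as origin, the ratio bound places all neighbours at distances in `[m, 2^K m)`, and
      -- the spanning ratio separates them with factor `S + 1`; then `separated⇒few` applies.
      degree-bound : ∀ S K → σ ℚ.+ 1ℚ ℚ.≤ Rationals.fromℕ (suc S) →
        seq (edgeLengthRatio Γ e) k ℚ.< Rationals.fromℕ 2 Rationals.^ K →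
        degree T v ℕ.≤ K ℕ.* (suc S ℕ.* 8 ℕ.* (suc S ℕ.* 8))
      degree-bound S K σ+1≤F ratio< = separated⇒few S K 0<m r (λ i → x v ℚ.- x (w i)) (λ i → y v ℚ.- y (w i)) m≤r r<
        (λ i → doubled-square {r i} {unit k} (0≤r i) (ℚ.<⇒≤ (Rationals.0<unit k)) (ℚ.≤-trans unit≤m (m≤r i))
          (gap²≤[dist+unit]² (position v) (position (w i)) k))
        separated
        where
        F : ℚ
        F = Rationals.fromℕ (suc S)
        r< : ∀ i → r i ℚ.< Rationals.fromℕ 2 Rationals.^ K ℚ.* m
        r< i = ℚ.≤-<-trans (maximum-upper {∥_,_∥ Γ v (w i)} {edgeLengths Γ} (edge∈edgeLengths (v~w i)) k) (÷-< {seq (longest Γ) k} {m} 0<m ratio<)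
        separated : ∀ i j → i ≢ j → (r i ℚ.+ r j) ℚ.* (r i ℚ.+ r j) ℚ.≤ F ℚ.* F ℚ.*
          ( ((x v ℚ.- x (w i)) ℚ.- (x v ℚ.- x (w j))) ℚ.* ((x v ℚ.- x (w i)) ℚ.- (x v ℚ.- x (w j)))
          ℚ.+ ((y v ℚ.- y (w i)) ℚ.- (y v ℚ.- y (w j))) ℚ.* ((y v ℚ.- y (w i)) ℚ.- (y v ℚ.- y (w j))) )
        -- Subtracting from `v` reverses differences, so the pair is taken in the order `w j`,
        -- `w i`.
        separated i j i≢j = ≤-cast refl
            (cong₂ (λ a b → F ℚ.* F ℚ.* (a ℚ.* a ℚ.+ b ℚ.* b)) (translate (x v) (x (w i)) (x (w j))) (translate (y v) (y (w i)) (y (w j))))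
            (product-square {r i ℚ.+ r j} {F} {D} {gap² (position (w j)) (position (w i)) k}
              (ℚ.+-mono-≤ (0≤r i) (0≤r j)) (0≤fromℕ (suc S)) (0≤dist (position (w j)) (position (w i)) k) close
              (dist²≤gap² (position (w j)) (position (w i)) k))
          where
          D : ℚ
          D = seq (∥_,_∥ Γ (w j) (w i)) k
          wj≢wi : w j ≢ w i
          wj≢wi eq = i≢j (sym (neighbour-injective T v eq))
          close : r i ℚ.+ r j ℚ.≤ F ℚ.* D
          close = ℚ.≤-trans (≤-cast (ℚ.+-comm (r i) (r j)) refl (two-edges≤π {v} {w j} {w i} (v~w j) (v~w i) wj≢wi k))
            (÷-≤ {seq (π Γ connected (w j) (w i)) k} {D} (apart (w j) (w i) wj≢wi)
              (ℚ.≤-trans (stretch≤spanningRatio {w j} {w i} wj≢wi k) (ℚ.≤-trans spanning σ+1≤F)))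

      ratio-bound : let u = Rationals.fromℕ (degree T v) ℚ.* inv (σ ℚ.* σ) in Rationals.fromℕ 8000 ℚ.≤ u →
        ¬ (seq (edgeLengthRatio Γ e) k ℚ.< root-2^ k (rate ℚ.* u))
      ratio-bound 8000≤u ratio< =
        let S , S≤ , <S = natural-part {σ ℚ.+ 1ℚ} (ℚ.≤-trans (ℚ.<⇒≤ (ℚ.positive⁻¹ ½)) (ℚ.≤-trans ½≤σ (Rationals.p≤p+q Rationals.0≤1)))
            K , K≤ , <K = natural-part {q} 0≤q
        in too-few-cells (degree T v) S K σ ½≤σ 8000≤u K≤ S≤
             -- `q < K + 1`, and `root-2^-≤` adds one more power, hence `K + 2` annuli.
             (degree-bound S (suc (suc K)) (ℚ.<⇒≤ <S) (ℚ.<-≤-trans ratio< (root-2^-≤ k q (suc K) (ℚ.<⇒≤ <K))))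
        where
        q : ℚ
        q = rate ℚ.* (Rationals.fromℕ (degree T v) ℚ.* inv (σ ℚ.* σ))
        0≤q : 0ℚ ℚ.≤ q
        0≤q = Rationals.0≤* (ℚ.nonNegative⁻¹ rate) (ℚ.≤-trans (0≤fromℕ 8000) 8000≤u)

-- The bound for real numbers.

module _ {n} {T : Graph n} (Γ : Drawing T) (connected : Connected T) (acyclic : Acyclic T) (v : Fin n)
  (s : ℝ) (1≤s : fromℕ 1 ≤ s) (spanning≤s : spanningRatio Γ connected ≤ s) where

  private
    d/s² : ℝ
    d/s² = fromℕ (degree T v) ÷ (s * s) ⟨ 0<⇒0<² s (1≤⇒0< s 1≤s) ⟩

  ratio-large : fromℕ 8001 ≤ d/s² → Σ (HasEdge T) λ e → 2^ (fromℚ rate * d/s²) ≤ edgeLengthRatio Γ e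
  ratio-large large = e , refute
    where
    -- Passing to an index loses 1, so the threshold 8001 supplies the 8000 needed by `ratio-bound`.
    large⇒ : Eventually (λ k → seq (fromℕ 8001) k ℚ.< seq d/s² k ℚ.+ 1ℚ)
    large⇒ = ≤⇒eventually (fromℕ 8001) d/s² large 1ℚ Rationals.0<1

    -- Degree zero would give `8001 < 1`; hence `v` has a neighbour, and `T` an edge.
    positive-degree : ∀ d t → Rationals.fromℕ 8001 ℚ.< Rationals.fromℕ d ℚ.* t ℚ.+ 1ℚ → Fin d
    positive-degree zero t h = ⊥-elim (<⇒≱ h (≤-cast (cong (ℚ._+ 1ℚ) (ℚ.*-zeroˡ t)) refl (toWitness {a? = _ ℚ.≤? _} _)))
    positive-degree (suc d) t h = zero

    e : HasEdge T
    e = degree⇒hasEdge T v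
      (positive-degree (degree T v) (inv (seq (s * s) (proj₁ large⇒))) (proj₂ large⇒ (proj₁ large⇒) ℕ.≤-refl))

    refute : ¬ (edgeLengthRatio Γ e < 2^ (fromℚ rate * d/s²))
    refute (ε , 0<ε , N , ratio<) = at (eventually-apart Γ
        ∧ (≤⇒eventually (fromℕ 1) s 1≤s ½ (ℚ.positive⁻¹ ½)
        ∧ (≤⇒eventually (spanningRatio Γ connected) s spanning≤s 1ℚ Rationals.0<1
        ∧ (large⇒ ∧ (0<⇒eventually (shortest Γ e) (shortest-positive Γ e) ∧ (N , ratio<))))))
      where
      Facts : ℕ → Set
      Facts k = (∀ a b → a ≢ b → 0ℚ ℚ.< seq (∥_,_∥ Γ a b) k)
        × 1ℚ ℚ.< seq s k ℚ.+ ½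
        × seq (spanningRatio Γ connected) k ℚ.< seq s k ℚ.+ 1ℚ
        × seq (fromℕ 8001) k ℚ.< seq d/s² k ℚ.+ 1ℚ
        × unit k ℚ.≤ seq (shortest Γ e) k
        × seq (edgeLengthRatio Γ e) k ℚ.+ ε ℚ.< seq (2^ (fromℚ rate * d/s²)) k
      absurd : ∀ k → Facts k → ⊥
      absurd k (apart , 1<σ+½ , spanning< , large< , unit≤m , ratio<) =
        At.ratio-bound Γ connected acyclic v k e (seq s k) apart (half-bound (seq s k) 1<σ+½) (ℚ.<⇒≤ spanning<) unit≤m
          (≤-from-<+1 8000 (seq d/s² k) large<) (ℚ.<-trans (Rationals.p<p+q 0<ε) ratio<)
      at : Eventually Facts → ⊥
      at (k , facts) = absurd k (facts k ℕ.≤-refl)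

theorem8 : Σ ℝ λ c → Σ ℝ λ x₀ → (fromℕ 0 < c) ×
    (∀ {n : ℕ} (T : Graph n) (tree : IsTree T) (v : Fin n) (d : ℕ) → degree T v ≡ d →
    (s : ℝ) (1≤s : fromℕ 1 ≤ s) (Γ : Drawing T) →
    spanningRatio Γ (IsTree.connected tree) ≤ s →
    let d/s² = fromℕ d ÷ (s * s) ⟨ 0<⇒0<² s (1≤⇒0< s 1≤s) ⟩ in
    x₀ ≤ d/s² →
    Σ (HasEdge T) λ e → 2^ (c * d/s²) ≤ edgeLengthRatio Γ e)
-- `1/5000` is a gap below `rate = 1/4000` that witnesses the positivity of the constant.
theorem8 = fromℚ rate , fromℕ 8001 , (+ 1 ℚ./ 5000 , ℚ.positive⁻¹ _ , 0 , λ _ _ → toWitness {a? = _ ℚ.<? _} _) ,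
  λ { T tree v _ refl s 1≤s Γ spanning≤s → ratio-large Γ (IsTree.connected tree) (IsTree.acyclic tree) v s 1≤s spanning≤s }
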